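{- For every planar graph $G$, every dominating set $D$ of $G$, and every owner assignment $m:V(G)\to D$, $$W=\sum_{x\in V(G)\setminus D}(k_x-2)^+\le(4|D|-12)^+.$$ In particular, if $W>0$, then $W\le 4|D|-12$.
   Context: All graphs are finite, simple and undirected. For $z\in\mathbb R$, $z^+=\max\{z,0\}$. $N(v)$ is the open neighborhood of $v$. Let $D$ be a dominating set of $G$ (every vertex is in $D$ or has a neighbor in $D$). An owner assignment is a map $m:V(G)\to D$ such that $m(d)=d$ for every $d\in D$, and $xm(x)\in E(G)$ for every $x\notin D$. For $d\in D$ the owner block of $d$ is $B_d=m^{ -1}(d)$. For $x\in V(G)\setminus D$ set $$C_{\mathrm{out}}(x)=\{c\in D\setminus\{m(x)\}:N(x)\cap B_c\neq\varnothing\},\qquad k_x=|C_{\mathrm{out}}(x)|.$$ -}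

module Defs where

open import Data.Fin.Base using (Fin)
open import Data.Fin.Permutation using (Permutation′; _⟨$⟩ʳ_; _∘ₚ_)
open import Data.Fin.Properties using (_≟_)
open import Data.Fin.Subset using (Subset; _∈_; _∉_; _∩_; Nonempty; ∣_∣)
open import Data.Fin.Subset.Properties using (_∈?_; nonempty?)
open import Data.List.Base using (allFin; filter; map)
open import Data.Nat.Base using (ℕ; _+_; _*_; _∸_)
open import Data.Nat.ListAction using (sum)
open import Data.Product.Base using (∃; _×_)
open import Data.Sum.Base using (_⊎_)
open import Data.Vec.Base using (tabulate)
open import Function.Bundles using (_⇔_)
open import Function.Definitions using (StrictlySurjective)
open import Level using (0ℓ)
open import Relation.Binary.Core using (Rel)
open import Relation.Binary.Construct.Closure.Equivalence using (EqClosure)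
open import Relation.Binary.Definitions using (Decidable; Irreflexive; Symmetric)
open import Relation.Binary.PropositionalEquality.Core using (_≡_; _≢_)
open import Relation.Nullary.Decidable using (does; ¬?; _×-dec_)
import Relation.Unary as U

record Graph (n : ℕ) : Set₁ where
  field
    Adj    : Rel (Fin n) 0ℓ
    adj?   : Decidable Adj
    sym    : Symmetric Adj
    irrefl : Irreflexive _≡_ Adj

-- Planarity is expressed by combinatorial maps (rotation systems): each edge
-- is split into two darts; α exchanges the two darts of an edge, and σ sends
-- a dart to the next dart, in cyclic order, leaving the same vertex.

record CombinatorialMap (d : ℕ) : Set where
  field
    σ α            : Permutation′ d
    α-involutive   : ∀ x → α ⟨$⟩ʳ (α ⟨$⟩ʳ x) ≡ x
    α-fixpointFree : ∀ x → α ⟨$⟩ʳ x ≢ x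

  -- Applies α first, then σ; its cycles are the boundary walks of the faces.
  φ : Permutation′ d
  φ = α ∘ₚ σ

Step : ∀ {d} → Permutation′ d → Rel (Fin d) 0ℓ
Step π x y = π ⟨$⟩ʳ x ≡ y

SameOrbit : ∀ {d} → Permutation′ d → Rel (Fin d) 0ℓ
SameOrbit π = EqClosure (Step π)

-- The equivalence relation generated by R has exactly k classes.
record Classes {d : ℕ} (R : Rel (Fin d) 0ℓ) (k : ℕ) : Set where
  field
    class      : Fin d → Fin k
    surjective : StrictlySurjective _≡_ class
    same-class : ∀ {x y} → class x ≡ class y ⇔ EqClosure R x y

-- Euler's formula V − E + F = 2C. Every connected component of a map has
-- V − E + F = 2 − 2g with g ≥ 0, where F counts the faces of each component
-- on its own surface, so the summed formula forces every genus to be 0.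
record GenusZero {d : ℕ} (M : CombinatorialMap d) : Set where
  open CombinatorialMap M
  field
    {V E F C}  : ℕ
    vertices   : Classes (Step σ) V
    edges      : Classes (Step α) E
    faces      : Classes (Step φ) F
    components : Classes (λ x y → Step σ x y ⊎ Step α x y) C
    euler      : V + F ≡ E + 2 * C

-- M is a rotation system on G: the darts correspond bijectively to the ordered
-- pairs of adjacent vertices, and σ permutes the darts at each vertex
-- cyclically. Isolated vertices carry no dart and impose no condition.
record RotationSystem {n d : ℕ} (G : Graph n) (M : CombinatorialMap d) : Set where
  open Graph G
  open CombinatorialMap M
  field
    tail : Fin d → Fin n

  head : Fin d → Fin n
  head x = tail (α ⟨$⟩ʳ x)

  field
    adjacent  : ∀ x → Adj (tail x) (head x)
    simple    : ∀ {x y} → tail x ≡ tail y → head x ≡ head y → x ≡ y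
    complete  : ∀ {u v} → Adj u v → ∃ λ x → tail x ≡ u × head x ≡ v
    same-tail : ∀ {x y} → tail x ≡ tail y ⇔ SameOrbit σ x y

record Planar {n : ℕ} (G : Graph n) : Set where
  field
    {darts}   : ℕ
    plane     : CombinatorialMap darts
    rotation  : RotationSystem G plane
    genusZero : GenusZero plane

⟪_⟫ : ∀ {n} {P : Fin n → Set} → U.Decidable P → Subset n
⟪ P? ⟫ = tabulate λ v → does (P? v)

module _ {n : ℕ} (G : Graph n) where
  open Graph G

  N : Fin n → Subset n
  N v = ⟪ adj? v ⟫

  Dominating : Subset n → Set
  Dominating D = ∀ v → v ∈ D ⊎ ∃ λ u → u ∈ D × Adj v u

  record IsOwnerAssignment (D : Subset n) (m : Fin n → Fin n) : Set where
    field
      owner-∈     : ∀ x → m x ∈ D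
      owner-fixed : ∀ {d} → d ∈ D → m d ≡ d
      owner-adj   : ∀ {x} → x ∉ D → Adj x (m x)

  module _ (D : Subset n) (m : Fin n → Fin n) where

    block : Fin n → Subset n
    block d = ⟪ (λ x → m x ≟ d) ⟫

    C-out : Fin n → Subset n
    C-out x = ⟪ (λ c → (c ∈? D) ×-dec ¬? (c ≟ m x) ×-dec nonempty? (N x ∩ block c)) ⟫

    k : Fin n → ℕ
    k x = ∣ C-out x ∣

    -- Truncated subtraction k x ∸ 2 is the positive part of k x − 2.
    W : ℕ
    W = sum (map (λ x → k x ∸ 2) (filter (λ x → ¬? (x ∈? D)) (allFin n)))

{-# OPTIONS --safe #-}
module Submission where

-- Call x ∉ D big when k x ≥ 3. Delete every edge of G except the spokes x — m x and the live edges,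
-- which join different blocks and have a big end, and contract the spokes. This gives a spherical
-- map with one vertex per block touched by a live edge. Charge a corner 1 if the two edges meeting
-- there lead to different blocks, and 2 if they lead to the same block, do not bound a digon, and
-- the corner lies in a block without big vertices.
--
-- The darts of a big x are consecutive around its contracted block, so they make at least k x − 1
-- turns between different neighbouring blocks; if x is the only big vertex of its block, the block
-- has at least k x turns. Hence the charge of each block is at least 2 plus its share of W. A face of
-- length 2, 3 or ℓ ≥ 4 has charge at most 0, 3 or 3ℓ/2 (two blocks without big vertices are never
-- adjacent), so at most 3ℓ − 6 in all cases. With V the number of blocks, Euler's formula bounds the
-- total charge by 6V − 12, whence W + 2V ≤ 6V − 12, and V ≤ ∣D∣.

-- The allowance `3ℓ − 6` of a face is chosen for its sum: over all faces it is six times the number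
-- of edges minus six times the number of faces, which Euler's formula bounds by `6V − 12`.
-- Contraction creates parallel edges, and a digon is then allowed nothing. Its corners are never
-- turns, but the extra charge of 2 has to be kept away from it. That extra charge exists for a
-- block whose live edges all lead to one neighbouring block: it has no turn, yet owes 2 like every
-- other block. It has no big vertex, since a big vertex sees at least three blocks. Some corner of
-- it lies outside the digons, for otherwise its neighbour, which contains the big ends of these
-- edges, would see no other block. That corner pays the whole debt. A triangle has only turns, and
-- a longer face can afford the payment because two such blocks are never joined by a live edge. The
-- 2 in `k x - 2` fits the loss of a turn where the rotation leaves `x`: `k x - 1` turns exceed the
-- excess of `x` by one, so two big vertices in a block already cover its debt of 2.

open import Defs
open import Data.Nat using (ℕ; zero; suc; _+_; _*_; _∸_; _≤_; _<_; z≤n; s≤s; _≤?_)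
open import Data.Fin using (Fin; zero; suc; punchIn; punchOut; toℕ)
open import Data.Fin.Subset as Sub using (Subset; ∣_∣; _∉_; _∩_; inside; outside)
open import Data.Product using (_×_; _,_; ∃; proj₁; proj₂; uncurry)

open import Data.Bool.Base using (if_then_else_)
open import Data.Fin.Permutation as Perm using (_⟨$⟩ʳ_)
open import Data.Fin.Permutation.Components using (transpose; transpose-inverse)
open import Data.Fin.Properties using (_≟_; any?; suc-injective; injective⇒≤; pigeonhole; punchOut-punchIn; punchInᵢ≢i; punchOut-cong; punchOut-injective)
open import Data.Fin.Subset.Properties using (_∈?_; x∈p∩q⁻; nonempty?)
open import Data.List.Base as List using (List; []; _∷_; filter; map; lookup; allFin; cartesianProduct)
open import Data.List.Membership.Propositional using (_∈_)
open import Data.List.Membership.Propositional.Properties using (∈-lookup; ∈-allFin; ∈-filter⁺; ∈-filter⁻; ∈-cartesianProduct⁺)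
open import Data.List.Relation.Unary.All as All using (All)
open import Data.List.Relation.Unary.Any using (here; there)
open import Data.List.Relation.Unary.Unique.Propositional using (Unique; []; _∷_)
open import Data.Nat.ListAction using () renaming (sum to sumᴸ)
open import Data.Nat.Properties hiding (_≟_; suc-injective)
open import Data.Nat.Tactic.RingSolver using (solve-∀)
open import Data.Sum using (_⊎_; inj₁; inj₂; [_,_]′)
open import Data.Vec.Base using ([]; _∷_)
open import Data.Vec.Properties using (lookup∘tabulate; []=⇒lookup)
open import Function.Base using (_∘_; id)
open import Function.Bundles using (Equivalence; mk⇔)
open import Function.Definitions using (Injective)
open import Level using (0ℓ)
open import Relation.Binary.Core using (Rel)
open import Relation.Binary.Definitions using (Decidable)
open import Relation.Binary.Construct.Closure.Equivalence as Eq using (EqClosure)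
open import Relation.Binary.Construct.Closure.ReflexiveTransitive using (ε; _◅_; _◅◅_)
open import Relation.Binary.Construct.Closure.Symmetric using (fwd; bwd)
open import Relation.Binary.PropositionalEquality hiding (resp)
open import Relation.Nullary using (¬_; contradiction)
open import Relation.Nullary.Decidable as Dec using (Dec; yes; no; does; _×-dec_; _⊎-dec_; ¬?; dec-true; dec-false; decidable-stable)
import Relation.Unary as U
open import Algebra.Properties.CommutativeMonoid.Sum +-0-commutativeMonoid using (sum; sum-cong-≗; ∑-distrib-+; ∑-comm)

private
  variable
    A B           : Set
    n d K L       : ℕ
    R S           : Rel (Fin d) 0ℓ
    a b w x y z   : Fin d
    f g           : Fin d → Fin d

-- Finite sums of natural numbers

𝟙 : Dec A → ℕ
𝟙 A? = if does A? then 1 else 0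

𝟙-yes : (A? : Dec A) → A → 𝟙 A? ≡ 1
𝟙-yes A? x = cong (if_then 1 else 0) (dec-true A? x)

𝟙-no : (A? : Dec A) → ¬ A → 𝟙 A? ≡ 0
𝟙-no A? ¬x = cong (if_then 1 else 0) (dec-false A? ¬x)

𝟙-mono : (A? : Dec A) (B? : Dec B) → (A → B) → 𝟙 A? ≤ 𝟙 B?
𝟙-mono (no _)  B? f = z≤n
𝟙-mono (yes x) B? f = ≤-reflexive (sym (𝟙-yes B? (f x)))

𝟙≤1 : (A? : Dec A) → 𝟙 A? ≤ 1
𝟙≤1 (yes _) = s≤s z≤n
𝟙≤1 (no _)  = z≤n

sum-mono : {f g : Fin n → ℕ} → (∀ i → f i ≤ g i) → sum f ≤ sum g
sum-mono {zero}  f≤g = z≤n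
sum-mono {suc n} f≤g = +-mono-≤ (f≤g zero) (sum-mono (f≤g ∘ suc))

term≤sum : (f : Fin n → ℕ) (i : Fin n) → f i ≤ sum f
term≤sum f zero    = m≤m+n _ _
term≤sum f (suc i) = ≤-trans (term≤sum (f ∘ suc) i) (m≤n+m _ _)

sum-const : ∀ n c → sum {n} (λ _ → c) ≡ n * c
sum-const zero    c = refl
sum-const (suc n) c = cong (c +_) (sum-const n c)

*-distribˡ-sum : ∀ c (f : Fin n → ℕ) → sum (λ i → c * f i) ≡ c * sum f
*-distribˡ-sum {zero}  c f = sym (*-zeroʳ c)
*-distribˡ-sum {suc n} c f =
  trans (cong (c * f zero +_) (*-distribˡ-sum c (f ∘ suc))) (sym (*-distribˡ-+ c (f zero) _))

sum-at-most-one : {P : U.Pred (Fin n) 0ℓ} (P? : U.Decidable P) (B? : Dec B) →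
                  (∀ {i j} → P i → P j → i ≡ j) → (∀ {i} → P i → B) →
                  sum (λ i → 𝟙 (P? i)) ≤ 𝟙 B?
sum-at-most-one {zero}  P? B? unique P⇒B = z≤n
sum-at-most-one {suc n} P? B? unique P⇒B with P? zero
... | no _   = sum-at-most-one (P? ∘ suc) B? (λ p q → suc-injective (unique p q)) P⇒B
... | yes p₀ = begin
  suc (sum (λ i → 𝟙 (P? (suc i))))  ≡⟨ cong suc (sum-cong-≗ λ i → 𝟙-no (P? (suc i)) λ p → contradiction (unique p₀ p) λ ()) ⟩
  suc (sum {n} (λ _ → 0))           ≡⟨ cong suc (trans (sum-const n 0) (*-zeroʳ n)) ⟩
  1                                 ≡⟨ 𝟙-yes B? (P⇒B p₀) ⟨
  𝟙 B?                              ∎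
  where open ≤-Reasoning

sum-δ : (f : Fin n → ℕ) (s : Fin n) → sum (λ i → 𝟙 (s ≟ i) * f i) ≡ f s
sum-δ {n} f s = ≤-antisym (begin
  sum (λ i → 𝟙 (s ≟ i) * f i)  ≤⟨ sum-mono bound ⟩
  sum (λ i → f s * 𝟙 (s ≟ i))  ≡⟨ *-distribˡ-sum (f s) (λ i → 𝟙 (s ≟ i)) ⟩
  f s * sum (λ i → 𝟙 (s ≟ i))  ≤⟨ *-monoʳ-≤ (f s) (sum-at-most-one (s ≟_) (yes s) (λ p q → trans (sym p) q) λ _ → s) ⟩
  f s * 1                      ≡⟨ *-identityʳ (f s) ⟩
  f s                          ∎)
  (begin
  f s                          ≡⟨ *-identityˡ (f s) ⟨
  1 * f s                      ≡⟨ cong (_* f s) (𝟙-yes (s ≟ s) refl) ⟨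
  𝟙 (s ≟ s) * f s              ≤⟨ term≤sum _ s ⟩
  sum (λ i → 𝟙 (s ≟ i) * f i)  ∎)
  where
  open ≤-Reasoning
  bound : ∀ i → 𝟙 (s ≟ i) * f i ≤ f s * 𝟙 (s ≟ i)
  bound i with s ≟ i
  ... | yes refl = ≤-reflexive (*-comm 1 (f s))
  ... | no _     = z≤n

sum-fibres : (c : Fin K → Fin L) (f : Fin K → ℕ) →
             sum f ≡ sum (λ j → sum (λ i → 𝟙 (c i ≟ j) * f i))
sum-fibres c f = trans (sum-cong-≗ λ i → sym (sum-δ (λ _ → f i) (c i))) (∑-comm λ i j → 𝟙 (c i ≟ j) * f i)

sum-reindex-≤ : {g : Fin K → Fin L} → Injective _≡_ _≡_ g → (f : Fin L → ℕ) →
                sum (f ∘ g) ≤ sum f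
sum-reindex-≤ {g = g} inj f = begin
  sum (f ∘ g)                                 ≡⟨ sum-cong-≗ (λ i → sym (sum-δ f (g i))) ⟩
  sum (λ i → sum (λ j → 𝟙 (g i ≟ j) * f j))   ≡⟨ ∑-comm (λ i j → 𝟙 (g i ≟ j) * f j) ⟩
  sum (λ j → sum (λ i → 𝟙 (g i ≟ j) * f j))   ≡⟨ sum-cong-≗ (λ j → trans (sum-cong-≗ λ i → *-comm (𝟙 (g i ≟ j)) (f j)) (*-distribˡ-sum (f j) λ i → 𝟙 (g i ≟ j))) ⟩
  sum (λ j → f j * sum (λ i → 𝟙 (g i ≟ j)))   ≤⟨ sum-mono (λ j → *-monoʳ-≤ (f j) (sum-at-most-one (λ i → g i ≟ j) (yes j) (λ p q → inj (trans p (sym q))) λ _ → j)) ⟩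
  sum (λ j → f j * 1)                         ≡⟨ sum-cong-≗ (λ j → *-identityʳ (f j)) ⟩
  sum f                                       ∎
  where open ≤-Reasoning

-- Double counting of the pairs related by `R`: every row in `P` contains such a pair, and every
-- column meets at most one row.
count-≤ : {P : U.Pred (Fin K) 0ℓ} (P? : U.Decidable P) {Q : U.Pred (Fin L) 0ℓ} (Q? : U.Decidable Q)
          {R : Fin K → Fin L → Set} (R? : ∀ i j → Dec (R i j)) →
          (∀ {i} → P i → ∃ λ j → Q j × R i j) →
          (∀ {i i′ j} → P i → P i′ → R i j → R i′ j → i ≡ i′) →
          sum (λ i → 𝟙 (P? i)) ≤ sum (λ j → 𝟙 (Q? j))
count-≤ P? Q? R? total inj = begin
  sum (λ i → 𝟙 (P? i))                  ≤⟨ sum-mono below ⟩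
  sum (λ i → sum (λ j → 𝟙 (T? i j)))    ≡⟨ ∑-comm (λ i j → 𝟙 (T? i j)) ⟩
  sum (λ j → sum (λ i → 𝟙 (T? i j)))    ≤⟨ sum-mono (λ j → sum-at-most-one (λ i → T? i j) (Q? j)
                                             (λ (p , _ , r) (p′ , _ , r′) → inj p p′ r r′) λ (_ , q , _) → q) ⟩
  sum (λ j → 𝟙 (Q? j))                  ∎
  where
  open ≤-Reasoning
  T? = λ i j → P? i ×-dec Q? j ×-dec R? i j
  below : ∀ i → 𝟙 (P? i) ≤ sum (λ j → 𝟙 (T? i j))
  below i with P? i
  ... | no _  = z≤n
  ... | yes p with total p
  ...   | j , q , r = ≤-trans (≤-reflexive (sym (𝟙-yes (yes p ×-dec Q? j ×-dec R? i j) (p , q , r))))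
                              (term≤sum (λ j → 𝟙 (yes p ×-dec Q? j ×-dec R? i j)) j)

∣p∣≡sum : (p : Subset n) → ∣ p ∣ ≡ sum (λ i → 𝟙 (i ∈? p))
∣p∣≡sum []            = refl
∣p∣≡sum (inside ∷ p)  = cong suc (∣p∣≡sum p)
∣p∣≡sum (outside ∷ p) = ∣p∣≡sum p

sum-filter : {P : U.Pred (Fin n) 0ℓ} (P? : U.Decidable P) (f : Fin n → ℕ) (g : Fin K → Fin n) →
             sumᴸ (map f (filter P? (List.tabulate g))) ≡ sum (λ i → 𝟙 (P? (g i)) * f (g i))
sum-filter {K = zero}  P? f g = refl
sum-filter {K = suc K} P? f g with P? (g zero)
... | yes _ = cong₂ _+_ (sym (*-identityˡ (f (g zero)))) (sum-filter P? f (g ∘ suc))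
... | no _  = sum-filter P? f (g ∘ suc)

lookup-injective : {xs : List A} → Unique xs → Injective _≡_ _≡_ (lookup xs)
lookup-injective (_ ∷ _)  {zero}  {zero}  _  = refl
lookup-injective (x∉ ∷ _) {zero}  {suc j} eq = contradiction eq (All.lookup x∉ (∈-lookup j))
lookup-injective (x∉ ∷ _) {suc i} {zero}  eq = contradiction (sym eq) (All.lookup x∉ (∈-lookup i))
lookup-injective (_ ∷ u)  {suc i} {suc j} eq = cong suc (lookup-injective u eq)

sum-lookup-≤ : {xs : List (Fin n)} → Unique xs → (f : Fin n → ℕ) → sum (f ∘ lookup xs) ≤ sum f
sum-lookup-≤ u f = sum-reindex-≤ (lookup-injective u) f

-- Counting equivalence classes and orbits

open Classes

relate : (c : Classes R K) → class c x ≡ class c y → EqClosure R x y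
relate c = Equivalence.to (same-class c)

related : (c : Classes R K) → EqClosure R x y → class c x ≡ class c y
related c = Equivalence.from (same-class c)

related? : Classes R K → ∀ x y → Dec (EqClosure R x y)
related? c x y = Dec.map (same-class c) (class c x ≟ class c y)

infix 4 _⊑_
_⊑_ : Rel (Fin d) 0ℓ → Rel (Fin d) 0ℓ → Set
R ⊑ S = ∀ {x y} → R x y → EqClosure S x y

eq-sym : EqClosure R x y → EqClosure R y x
eq-sym = Eq.symmetric _

classes-resp : R ⊑ S → S ⊑ R → Classes R K → Classes S K
classes-resp R⊑S S⊑R c = record
  { class      = class c
  ; surjective = surjective c
  ; same-class = mk⇔ (λ eq → (R⊑S Eq.⋆) (relate c eq)) (λ eq → related c ((S⊑R Eq.⋆) eq))
  }

classes-antitone : R ⊑ S → Classes R K → Classes S L → L ≤ K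
classes-antitone R⊑S c c′ = injective⇒≤ {f = class c ∘ proj₁ ∘ surjective c′} λ {i} {j} eq →
  trans (sym (proj₂ (surjective c′ i))) (trans (related c′ ((R⊑S Eq.⋆) (relate c eq))) (proj₂ (surjective c′ j)))

classes-≡ : R ⊑ S → S ⊑ R → Classes R K → Classes S L → K ≡ L
classes-≡ R⊑S S⊑R c c′ = ≤-antisym (classes-antitone S⊑R c′ c) (classes-antitone R⊑S c c′)

infixl 6 _∪⟨_,_⟩
_∪⟨_,_⟩ : Rel (Fin d) 0ℓ → Fin d → Fin d → Rel (Fin d) 0ℓ
(R ∪⟨ a , b ⟩) x y = R x y ⊎ (x ≡ a × y ≡ b)

pair : EqClosure (R ∪⟨ a , b ⟩) a b
pair = Eq.return (inj₂ (refl , refl))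

∪-⊑ : R ⊑ S → EqClosure S a b → R ∪⟨ a , b ⟩ ⊑ S
∪-⊑ R⊑S ab (inj₁ r)             = R⊑S r
∪-⊑ R⊑S ab (inj₂ (refl , refl)) = ab

⊑-∪ : R ⊑ R ∪⟨ a , b ⟩
⊑-∪ = Eq.return ∘ inj₁

join-related : EqClosure R a b → Classes R K → Classes (R ∪⟨ a , b ⟩) K
join-related ab = classes-resp ⊑-∪ (∪-⊑ Eq.return ab)

-- The label of `b` is struck out and its members take over the label of `a`, so exactly one class
-- disappears.
join-unrelated : ¬ EqClosure R a b → Classes R K → ∃ λ L → K ≡ suc L × Classes (R ∪⟨ a , b ⟩) L
join-unrelated {a = a} {K = zero} ¬ab c with () ← class c a
join-unrelated {R = R} {a = a} {b = b} {K = suc L} ¬ab c = L , refl , record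
  { class      = quot ∘ class c
  ; surjective = λ j → proj₁ (surjective c (punchIn cb j)) ,
      trans (cong quot (proj₂ (surjective c (punchIn cb j)))) (quot-punchIn j)
  ; same-class = mk⇔ (from-quot _ _) (λ eq → Eq.fold (record { refl = refl ; sym = sym ; trans = trans }) step eq)
  }
  where
  ca = class c a
  cb = class c b
  cb≢ca : cb ≢ ca
  cb≢ca eq = ¬ab (relate c (sym eq))
  quot : Fin (suc L) → Fin L
  quot i with cb ≟ i
  ... | yes _  = punchOut cb≢ca
  ... | no neq = punchOut neq
  quot-ca : quot ca ≡ quot cb
  quot-ca with cb ≟ ca | cb ≟ cb
  ... | yes eq | _      = contradiction eq cb≢ca
  ... | no _   | no neq = contradiction refl neq
  ... | no _   | yes _  = punchOut-cong cb refl
  quot-punchIn : ∀ j → quot (punchIn cb j) ≡ j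
  quot-punchIn j with cb ≟ punchIn cb j
  ... | yes eq = contradiction (sym eq) (punchInᵢ≢i cb j)
  ... | no neq = trans (punchOut-cong cb refl) (punchOut-punchIn cb)
  toʳ : class c x ≡ class c y → EqClosure (R ∪⟨ a , b ⟩) x y
  toʳ eq = (⊑-∪ Eq.⋆) (relate c eq)
  from-quot : ∀ x y → quot (class c x) ≡ quot (class c y) → EqClosure (R ∪⟨ a , b ⟩) x y
  from-quot x y eq with cb ≟ class c x | cb ≟ class c y
  ... | yes p | yes q = toʳ (trans (sym p) q)
  ... | yes p | no q  = toʳ (sym p) ◅◅ eq-sym pair ◅◅ toʳ (punchOut-injective cb≢ca q eq)
  ... | no p  | yes q = toʳ (punchOut-injective p cb≢ca eq) ◅◅ pair ◅◅ toʳ q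
  ... | no p  | no q  = toʳ (punchOut-injective p q eq)
  step : ∀ {x y} → (R ∪⟨ a , b ⟩) x y → quot (class c x) ≡ quot (class c y)
  step (inj₁ r)             = cong quot (related c (Eq.return r))
  step (inj₂ (refl , refl)) = quot-ca

classes-∷ : ∀ {ps} → Classes ((λ x y → (x , y) ∈ ps) ∪⟨ a , b ⟩) K →
            Classes (λ x y → (x , y) ∈ (a , b) ∷ ps) K
classes-∷ = classes-resp
  (λ { (inj₁ p) → Eq.return (there p) ; (inj₂ (refl , refl)) → Eq.return (here refl) })
  (λ { (here refl) → pair ; (there p) → Eq.return (inj₁ p) })

classes-pairs : (ps : List (Fin d × Fin d)) → ∃ (Classes (λ x y → (x , y) ∈ ps))
classes-pairs [] = _ , record
  { class      = id
  ; surjective = λ j → j , refl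
  ; same-class = mk⇔ (λ { refl → ε }) (Eq.fold isEquivalence λ ())
  }
classes-pairs ((a , b) ∷ ps) with classes-pairs ps
... | _ , c with related? c a b
...   | yes ab = _ , classes-∷ (join-related ab c)
...   | no ¬ab = _ , classes-∷ (proj₂ (proj₂ (join-unrelated ¬ab c)))

-- The related pairs are added one at a time to the discrete partition. Each partition along the way
-- decides its own closure, which settles whether the next pair merges two classes.
classes-exist : {R : Rel (Fin d) 0ℓ} → Decidable R → ∃ (Classes R)
classes-exist {d = d} R? with classes-pairs (filter (uncurry R?) (cartesianProduct (allFin d) (allFin d)))
... | K , c = K , classes-resp
  (λ p → Eq.return (proj₂ (∈-filter⁻ (uncurry R?) {xs = cartesianProduct (allFin d) (allFin d)} p)))
  (λ r → Eq.return (∈-filter⁺ (uncurry R?) (∈-cartesianProduct⁺ (∈-allFin _) (∈-allFin _)) r)) c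

-- A class is shown to be heavy by a few explicit members, so that no class has to be enumerated.
classes-weight : Classes R K → (w : Fin d → ℕ) (t : ℕ) →
                 (∀ x → ∃ λ xs → Unique xs × All (EqClosure R x) xs × t ≤ sum (w ∘ lookup xs)) →
                 K * t ≤ sum w
classes-weight {K = K} c w t heavy = begin
  K * t                                              ≡⟨ sum-const K t ⟨
  sum {K} (λ _ → t)                                  ≤⟨ sum-mono class-heavy ⟩
  sum (λ j → sum (λ x → 𝟙 (class c x ≟ j) * w x))    ≡⟨ sum-fibres (class c) w ⟨
  sum w                                              ∎
  where
  open ≤-Reasoning
  class-heavy : ∀ j → t ≤ sum (λ x → 𝟙 (class c x ≟ j) * w x)
  class-heavy j with surjective c j
  ... | x , refl with heavy x
  ...   | xs , unique , rel , t≤ = begin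
    t                        ≤⟨ t≤ ⟩
    sum (w ∘ lookup xs)      ≡⟨ sum-cong-≗ (λ i → trans (sym (*-identityˡ _)) (cong (_* w (lookup xs i))
                                  (sym (𝟙-yes (class c (lookup xs i) ≟ class c x) (sym (related c (All.lookup rel (∈-lookup i)))))))) ⟩
    sum (w′ ∘ lookup xs)     ≤⟨ sum-lookup-≤ unique w′ ⟩
    sum w′                   ∎
    where
    w′ = λ y → 𝟙 (class c y ≟ class c x) * w y

-- Orbits of a map, and how a transposition changes their number

StepF : (Fin d → Fin d) → Rel (Fin d) 0ℓ
StepF f x y = f x ≡ y

stepF? : (f : Fin d → Fin d) → Decidable (StepF f)
stepF? f x y = f x ≟ y

infix 4 _∼[_]_
_∼[_]_ : Fin d → (Fin d → Fin d) → Fin d → Set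
x ∼[ f ] y = EqClosure (StepF f) x y

iter : (Fin d → Fin d) → ℕ → Fin d → Fin d
iter f zero    x = x
iter f (suc i) x = iter f i (f x)

iter-+ : ∀ i j → iter f (i + j) x ≡ iter f j (iter f i x)
iter-+ zero    j = refl
iter-+ (suc i) j = iter-+ i j

iter-suc : ∀ i → iter f (suc i) x ≡ f (iter f i x)
iter-suc zero    = refl
iter-suc (suc i) = iter-suc i

iter-injective : Injective _≡_ _≡_ f → ∀ i → Injective _≡_ _≡_ (iter f i)
iter-injective inj zero    eq = eq
iter-injective inj (suc i) eq = inj (iter-injective inj i eq)

iter-related : ∀ i → x ∼[ f ] iter f i x
iter-related zero    = ε
iter-related (suc i) = fwd refl ◅ iter-related i

periodic : Injective _≡_ _≡_ f → ∀ (x : Fin d) → ∃ λ i → iter f (suc i) x ≡ x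
periodic {f = f} inj x with pigeonhole (n<1+n _) (λ i → iter f (toℕ i) x)
... | i , j , i<j , eq with m≤n⇒∃[o]m+o≡n i<j
...   | o , refl≡ = o , sym (iter-injective inj (toℕ i) (begin
  iter f (toℕ i) x                    ≡⟨ eq ⟩
  iter f (toℕ j) x                    ≡⟨ cong (λ n → iter f n x) (trans (sym refl≡) (+-comm (suc (toℕ i)) o)) ⟩
  iter f (o + suc (toℕ i)) x          ≡⟨ cong (λ n → iter f n x) (+-suc o (toℕ i)) ⟩
  iter f (suc o + toℕ i) x            ≡⟨ iter-+ {f = f} {x = x} (suc o) (toℕ i) ⟩
  iter f (toℕ i) (iter f (suc o) x)   ∎))
  where open ≡-Reasoning

-- A backward step from `f y` to `y` is replaced by going forward through the rest of the cycle of
-- `y`.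
orbit-iter : Injective _≡_ _≡_ f → x ∼[ f ] y → ∃ λ i → iter f i x ≡ y
orbit-iter inj ε = 0 , refl
orbit-iter inj (fwd refl ◅ r) with orbit-iter inj r
... | i , eq = suc i , eq
orbit-iter {f = f} inj (_◅_ {j = y} (bwd refl) r) with orbit-iter inj r | periodic inj y
... | i , eq | j , per = j + i , trans (iter-+ {f = f} j i) (trans (cong (iter f i) per) eq)

isolated : (∀ {x} → R x a → x ≡ a) → (∀ {x} → R a x → x ≡ a) → EqClosure R a b → b ≡ a
isolated in≡ out≡ ε = refl
isolated in≡ out≡ (fwd r ◅ rs) with refl ← out≡ r = isolated in≡ out≡ rs
isolated in≡ out≡ (bwd r ◅ rs) with refl ← in≡ r  = isolated in≡ out≡ rs

fixed-isolated : Injective _≡_ _≡_ f → f a ≡ a → a ∼[ f ] b → b ≡ a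
fixed-isolated inj fa = isolated (λ fx → inj (trans fx (sym fa))) (λ fa′ → trans (sym fa′) fa)

-- `g` is `f` preceded by the transposition of `a` and `b`. Stated by values, the relation is
-- symmetric in `f` and `g`, so the same lemmas serve for merging cycles and for splitting them.
record Swapped (f g : Fin d → Fin d) (a b : Fin d) : Set where
  field
    atˡ  : g a ≡ f b
    atʳ  : g b ≡ f a
    else : ∀ {x} → x ≢ a → x ≢ b → g x ≡ f x
open Swapped

swapped-sym : Swapped f g a b → Swapped g f a b
swapped-sym s = record { atˡ = sym (atʳ s) ; atʳ = sym (atˡ s) ; else = λ p q → sym (else s p q) }

swapped-∘ : ∀ (h : Fin d → Fin d) → Swapped f g a b → Swapped (h ∘ f) (h ∘ g) a b
swapped-∘ h s = record { atˡ = cong h (atˡ s) ; atʳ = cong h (atʳ s) ; else = λ p q → cong h (else s p q) }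

swapped-⊑ : Swapped f g a b → StepF g ⊑ StepF f ∪⟨ a , b ⟩
swapped-⊑ {a = a} {b = b} s {x} refl with x ≟ a | x ≟ b
... | yes refl | _        = pair ◅◅ Eq.return (inj₁ (sym (atˡ s)))
... | no _     | yes refl = eq-sym pair ◅◅ Eq.return (inj₁ (sym (atʳ s)))
... | no p     | no q     = Eq.return (inj₁ (sym (else s p q)))

-- Following f from b, the g-orbit of a runs through the whole f-orbit of b, which misses a.
swapped-merges : Injective _≡_ _≡_ f → Swapped f g a b → ¬ a ∼[ f ] b → a ∼[ g ] b
swapped-merges {f = f} {g = g} {a = a} {b = b} inj s ¬ab with periodic inj b
... | i , per = [ id , (λ r → subst (a ∼[ g ]_) per r) ]′ (walk i)
  where
  walk : ∀ i → a ∼[ g ] b ⊎ a ∼[ g ] iter f (suc i) b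
  walk zero = inj₂ (Eq.return (atˡ s))
  walk (suc i) with walk i
  ... | inj₁ r = inj₁ r
  ... | inj₂ r with iter f (suc i) b ≟ b
  ...   | yes eq = inj₁ (subst (a ∼[ g ]_) eq r)
  ...   | no neq = inj₂ (r ◅◅ Eq.return (trans (else s ≢a neq) (sym (iter-suc {f = f} (suc i)))))
    where
    ≢a : iter f (suc i) b ≢ a
    ≢a eq = ¬ab (eq-sym (subst (b ∼[ f ]_) eq (iter-related (suc i))))

-- Steps of `g` stay inside the relation of `f` with the pair `a`, `b` added, and one pair merges at
-- most two classes.
swapped-count-≤ : Swapped f g a b → Classes (StepF f) K → Classes (StepF g) L → K ≤ suc L
swapped-count-≤ {a = a} {b = b} s c c′ with related? c a b
... | yes ab = m≤n⇒m≤1+n (classes-antitone (swapped-⊑ s) c′ (join-related ab c))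
... | no ¬ab with join-unrelated ¬ab c
...   | j , refl , cj = s≤s (classes-antitone (swapped-⊑ s) c′ cj)

-- Since `g` relates `a` to `b`, it generates the same equivalence as `f` with this pair added.
swapped-count : Injective _≡_ _≡_ f → Swapped f g a b → ¬ a ∼[ f ] b →
                Classes (StepF f) K → Classes (StepF g) L → K ≡ suc L
swapped-count inj s ¬ab c c′ with join-unrelated ¬ab c
... | j , refl , cj = cong suc (classes-≡
  (∪-⊑ (λ r → (∪-⊑ Eq.return (swapped-merges inj s ¬ab) Eq.⋆) (swapped-⊑ (swapped-sym s) r)) (swapped-merges inj s ¬ab)) (swapped-⊑ s) cj c′)

_∪ˢ_ : (σ α : Fin d → Fin d) → Rel (Fin d) 0ℓ
(σ ∪ˢ α) x y = σ x ≡ y ⊎ α x ≡ y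

∪ˢ? : (σ α : Fin d → Fin d) → Decidable (σ ∪ˢ α)
∪ˢ? σ α x y = (σ x ≟ y) Dec.⊎-dec (α x ≟ y)

∪ˢ-⊑ : StepF f ⊑ R → StepF g ⊑ R → f ∪ˢ g ⊑ R
∪ˢ-⊑ p q = [ p , q ]′

∪ˢ-left : StepF f ⊑ f ∪ˢ g
∪ˢ-left = Eq.return ∘ inj₁

∪ˢ-right : StepF g ⊑ f ∪ˢ g
∪ˢ-right = Eq.return ∘ inj₂

-- V − (d − E) + F ≥ 2C, where E is the number of α-orbits: d − E is the number of edges, since α may
-- have fixed points. A dart fixed by σ and α is an isolated vertex with its own face and component.
record Spherical (σ α : Fin d → Fin d) : Set where
  field
    {V E F C}  : ℕ
    vertices   : Classes (StepF σ) V
    edges      : Classes (StepF α) E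
    faces      : Classes (StepF (σ ∘ α)) F
    components : Classes (σ ∪ˢ α) C
    euler      : d + 2 * C ≤ V + E + F

-- Deleting edges, contracting edges and removing marks

∘-injective : Injective _≡_ _≡_ f → Injective _≡_ _≡_ g → Injective _≡_ _≡_ (f ∘ g)
∘-injective p q eq = q (p eq)

-- If the two ends stay connected, the number of faces falls by at most one, which the splitting of
-- the `α`-orbit makes up for. If they do not, they lie in different faces of the new map, because a
-- face stays within a component; the new component, worth 2 in Euler's formula, is paid by one more
-- `α`-orbit and one more face.
delete-edge : ∀ {d} {σ α α′ : Fin d → Fin d} {a b} → Injective _≡_ _≡_ σ → Injective _≡_ _≡_ α′ → Swapped α α′ a b → a ≢ b →
              α′ a ≡ a → α′ b ≡ b → Spherical σ α → Spherical σ α′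
delete-edge {d} {σ} {α} {α′} {a} {b} injσ injα′ s a≢b α′a α′b M = record
  { vertices   = vertices M
  ; edges      = edges′
  ; faces      = faces′
  ; components = comps′
  ; euler      = euler′ (related? comps′ a b)
  }
  where
  open Spherical
  edges′ = proj₂ (classes-exist (stepF? α′))
  faces′ = proj₂ (classes-exist (stepF? (σ ∘ α′)))
  comps′ = proj₂ (classes-exist (∪ˢ? σ α′))
  E′ = proj₁ (classes-exist (stepF? α′))
  F′ = proj₁ (classes-exist (stepF? (σ ∘ α′)))
  C′ = proj₁ (classes-exist (∪ˢ? σ α′))
  E≡ : E′ ≡ suc (E M)
  E≡ = swapped-count injα′ (swapped-sym s) (λ ab → a≢b (sym (fixed-isolated injα′ α′a ab))) edges′ (edges M)
  sφ : Swapped (σ ∘ α) (σ ∘ α′) a b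
  sφ = swapped-∘ σ s
  αa≡b : α a ≡ b
  αa≡b = trans (sym (atʳ s)) α′b
  joined : (σ ∪ˢ α′) ∪⟨ a , b ⟩ ⊑ σ ∪ˢ α
  joined = ∪-⊑ (∪ˢ-⊑ ∪ˢ-left λ r → (∪-⊑ ∪ˢ-right (∪ˢ-right αa≡b) Eq.⋆) (swapped-⊑ s r)) (∪ˢ-right αa≡b)
  unjoined : σ ∪ˢ α ⊑ (σ ∪ˢ α′) ∪⟨ a , b ⟩
  unjoined = ∪ˢ-⊑ (λ r → Eq.return (inj₁ (inj₁ r)))
    λ r → (∪-⊑ (λ r → Eq.return (inj₁ (inj₂ r))) pair Eq.⋆) (swapped-⊑ (swapped-sym s) r)
  open ≤-Reasoning
  euler′ : Dec (EqClosure (σ ∪ˢ α′) a b) → d + 2 * C′ ≤ V M + E′ + F′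
  euler′ (yes ab) = begin
    d + 2 * C′             ≡⟨ cong (λ c → d + 2 * c) (classes-≡ joined unjoined (join-related ab comps′) (components M)) ⟩
    d + 2 * C M            ≤⟨ euler M ⟩
    V M + E M + F M        ≤⟨ +-monoʳ-≤ (V M + E M) (swapped-count-≤ sφ (faces M) faces′) ⟩
    V M + E M + suc F′     ≡⟨ shift (V M) (E M) F′ ⟩
    V M + suc (E M) + F′   ≡⟨ cong (λ e → V M + e + F′) E≡ ⟨
    V M + E′ + F′          ∎
    where
    shift : ∀ v e f → v + e + suc f ≡ v + suc e + f
    shift = solve-∀
  euler′ (no ¬ab) with join-unrelated ¬ab comps′
  ... | C″ , C′≡ , comps″ = begin
    d + 2 * C′                   ≡⟨ cong (λ c → d + 2 * c) (trans C′≡ (cong suc (classes-≡ joined unjoined comps″ (components M)))) ⟩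
    d + 2 * suc (C M)            ≡⟨ shift₁ d (C M) ⟩
    2 + (d + 2 * C M)            ≤⟨ +-monoʳ-≤ 2 (euler M) ⟩
    2 + (V M + E M + F M)        ≡⟨ shift₂ (V M) (E M) (F M) ⟩
    V M + suc (E M) + suc (F M)  ≡⟨ cong₂ (λ e f → V M + e + f) E≡ F≡ ⟨
    V M + E′ + F′                ∎
    where
    shift₁ : ∀ d c → d + 2 * suc c ≡ 2 + (d + 2 * c)
    shift₁ = solve-∀
    shift₂ : ∀ v e f → 2 + (v + e + f) ≡ v + suc e + suc f
    shift₂ = solve-∀
    φ-⊑ : StepF (σ ∘ α′) ⊑ σ ∪ˢ α′
    φ-⊑ r = ∪ˢ-right refl ◅◅ ∪ˢ-left r
    F≡ : F′ ≡ suc (F M)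
    F≡ = swapped-count (∘-injective injσ injα′) (swapped-sym sφ) (λ ab → ¬ab ((φ-⊑ Eq.⋆) ab)) faces′ (faces M)

-- Swapping the same two darts in `σ` and in `α` leaves `σ ∘ α` unchanged, so every face survives.
-- The swap in `σ` merges the two end vertices, the swap in `α` splits the edge, and the two darts
-- stay in the merged rotation as fixed points of `α`.
contract-edge : ∀ {d} {σ σ′ α α′ : Fin d → Fin d} {a b} → Injective _≡_ _≡_ σ → Injective _≡_ _≡_ α′ → Swapped σ σ′ a b → Swapped α α′ a b →
                ¬ a ∼[ σ ] b → α′ a ≡ a → α′ b ≡ b → Spherical σ α → Spherical σ′ α′
contract-edge {d} {σ} {σ′} {α} {α′} {a} {b} injσ injα′ sσ sα ¬ab α′a α′b M = record
  { vertices   = vertices′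
  ; edges      = edges′
  ; faces      = classes-resp (λ { refl → Eq.return (sym (φ≗ _)) }) (λ { refl → Eq.return (φ≗ _) }) (faces M)
  ; components = classes-resp unmerge merge (components M)
  ; euler      = begin
      d + 2 * C M               ≤⟨ euler M ⟩
      V M + E M + F M           ≡⟨ cong (λ v → v + E M + F M) V≡ ⟩
      suc V′ + E M + F M        ≡⟨ cong (_+ F M) (sym (+-suc V′ (E M))) ⟩
      V′ + suc (E M) + F M      ≡⟨ cong (λ e → V′ + e + F M) E≡ ⟨
      V′ + E′ + F M             ∎
  }
  where
  open Spherical
  open ≤-Reasoning
  vertices′ = proj₂ (classes-exist (stepF? σ′))
  edges′ = proj₂ (classes-exist (stepF? α′))
  V′ = proj₁ (classes-exist (stepF? σ′))
  E′ = proj₁ (classes-exist (stepF? α′))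
  a≢b : a ≢ b
  a≢b refl = ¬ab ε
  αa≡b : α a ≡ b
  αa≡b = trans (sym (atʳ sα)) α′b
  αb≡a : α b ≡ a
  αb≡a = trans (sym (atˡ sα)) α′a
  V≡ : V M ≡ suc V′
  V≡ = swapped-count injσ sσ ¬ab (vertices M) vertices′
  E≡ : E′ ≡ suc (E M)
  E≡ = swapped-count injα′ (swapped-sym sα) (λ ab → a≢b (sym (fixed-isolated injα′ α′a ab))) edges′ (edges M)
  φ≗ : ∀ x → σ (α x) ≡ σ′ (α′ x)
  φ≗ x with x ≟ a | x ≟ b
  ... | yes refl | _        = trans (cong σ αa≡b) (trans (sym (atˡ sσ)) (cong σ′ (sym α′a)))
  ... | no _     | yes refl = trans (cong σ αb≡a) (trans (sym (atʳ sσ)) (cong σ′ (sym α′b)))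
  ... | no x≢a   | no x≢b   = sym (trans (else sσ α′x≢a α′x≢b) (cong σ (else sα x≢a x≢b)))
    where
    α′x≢a : α′ x ≢ a
    α′x≢a eq = x≢a (injα′ (trans eq (sym α′a)))
    α′x≢b : α′ x ≢ b
    α′x≢b eq = x≢b (injα′ (trans eq (sym α′b)))
  ab : a ∼[ σ′ ] b
  ab = swapped-merges injσ sσ ¬ab
  merge : σ′ ∪ˢ α′ ⊑ σ ∪ˢ α
  merge = ∪ˢ-⊑ (λ r → (∪-⊑ ∪ˢ-left (∪ˢ-right αa≡b) Eq.⋆) (swapped-⊑ sσ r))
               (λ r → (∪-⊑ ∪ˢ-right (∪ˢ-right αa≡b) Eq.⋆) (swapped-⊑ sα r))
  ab′ : EqClosure (σ′ ∪ˢ α′) a b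
  ab′ = (∪ˢ-left Eq.⋆) ab
  unmerge : σ ∪ˢ α ⊑ σ′ ∪ˢ α′
  unmerge = ∪ˢ-⊑ (λ r → (∪-⊑ ∪ˢ-left ab′ Eq.⋆) (swapped-⊑ (swapped-sym sσ) r))
                 (λ r → (∪-⊑ ∪ˢ-right ab′ Eq.⋆) (swapped-⊑ (swapped-sym sα) r))

record Bypass (z : Fin d) (f g : Fin d → Fin d) : Set where
  field
    fixed : g z ≡ z
    jump  : ∀ {x} → x ≢ z → f x ≡ z → g x ≡ f z
    keep  : ∀ {x} → x ≢ z → f x ≢ z → g x ≡ f x
open Bypass

bypass-⊑ : Bypass z f g → StepF g ⊑ StepF f
bypass-⊑ {z = z} {f = f} p {x} refl with x ≟ z | f x ≟ z
... | yes refl | _      = subst (_ ∼[ f ]_) (sym (fixed p)) ε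
... | no x≢z   | yes fx = Eq.return fx ◅◅ Eq.return (sym (jump p x≢z fx))
... | no x≢z   | no ≢z  = Eq.return (sym (keep p x≢z ≢z))

⊑-bypass : Bypass z f g → StepF f ⊑ StepF g ∪⟨ z , f z ⟩
⊑-bypass {z = z} {f = f} p {x} refl with x ≟ z | f x ≟ z
... | yes refl | _      = pair
... | no x≢z   | yes fx = Eq.return (inj₁ (jump p x≢z fx)) ◅◅ eq-sym pair ◅◅ subst (EqClosure _ z) (sym fx) ε
... | no x≢z   | no ≢z  = Eq.return (inj₁ (keep p x≢z ≢z))

bypass-avoids : Injective _≡_ _≡_ f → Bypass z f g → x ≢ z → g x ≢ z
bypass-avoids {f = f} {z = z} {x = x} inj p x≢z gx with f x ≟ z
... | yes fx = x≢z (inj (trans fx (trans (sym gx) (jump p x≢z fx))))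
... | no ≢z  = ≢z (trans (sym (keep p x≢z ≢z)) gx)

bypass-injective : Injective _≡_ _≡_ f → Bypass z f g → Injective _≡_ _≡_ g
bypass-injective {f = f} {z = z} inj p {x} {y} eq with x ≟ z | y ≟ z
... | yes refl | yes refl = refl
... | yes refl | no y≢z   = contradiction (trans (sym eq) (fixed p)) (bypass-avoids inj p y≢z)
... | no x≢z   | yes refl = contradiction (trans eq (fixed p)) (bypass-avoids inj p x≢z)
... | no x≢z   | no y≢z with f x ≟ z | f y ≟ z
...   | yes fx | yes fy = inj (trans fx (sym fy))
...   | yes fx | no ≢z  = contradiction (inj (trans (sym (jump p x≢z fx)) (trans eq (keep p y≢z ≢z)))) (y≢z ∘ sym)
...   | no ≢z  | yes fy = contradiction (inj (trans (sym (keep p x≢z ≢z)) (trans eq (jump p y≢z fy)))) x≢z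
...   | no ≢z  | no ≢z′ = inj (trans (sym (keep p x≢z ≢z)) (trans eq (keep p y≢z ≢z′)))

bypass-∘ : ∀ {σ σ′ α : Fin d → Fin d} → Injective _≡_ _≡_ α → α z ≡ z → Bypass z σ σ′ → Bypass z (σ ∘ α) (σ′ ∘ α)
bypass-∘ {z = z} {σ = σ} {σ′ = σ′} inj αz p = record
  { fixed = trans (cong σ′ αz) (fixed p)
  ; jump  = λ x≢z eq → trans (jump p (≢z x≢z) eq) (cong σ (sym αz))
  ; keep  = λ x≢z → keep p (≢z x≢z)
  }
  where
  ≢z : x ≢ z → _
  ≢z x≢z eq = x≢z (inj (trans eq (sym αz)))

bypass-unrelated : Injective _≡_ _≡_ f → Bypass z f g → f z ≢ z → ¬ z ∼[ g ] f z
bypass-unrelated inj p fz≢z r = fz≢z (fixed-isolated (bypass-injective inj p) (fixed p) r)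

bypass-count : Injective _≡_ _≡_ f → Bypass z f g → f z ≢ z →
               Classes (StepF f) K → Classes (StepF g) L → L ≡ suc K
bypass-count inj p fz≢z c c′ with join-unrelated (bypass-unrelated inj p fz≢z) c′
... | j , refl , cj = cong suc (classes-≡ (∪-⊑ (bypass-⊑ p) (Eq.return refl)) (⊑-bypass p) cj c)

-- Because `α` fixes `z`, taking `z` out of its `σ`-cycle also takes it out of its face. It becomes
-- an isolated vertex: the 2 for the new component is matched by one new vertex and one new face.
remove-mark : ∀ {d} {σ σ′ α : Fin d → Fin d} {z} → Injective _≡_ _≡_ σ → Injective _≡_ _≡_ α →
              Bypass z σ σ′ → σ z ≢ z → α z ≡ z → Spherical σ α → Spherical σ′ α
remove-mark {d} {σ} {σ′} {α} {z} injσ injα p σz≢z αz M = record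
  { vertices   = vertices′
  ; edges      = edges M
  ; faces      = faces′
  ; components = comps′
  ; euler      = begin
      d + 2 * C′                       ≡⟨ cong (λ c → d + 2 * c) C≡ ⟩
      d + 2 * suc (C M)                ≡⟨ shift₁ d (C M) ⟩
      2 + (d + 2 * C M)                ≤⟨ +-monoʳ-≤ 2 (euler M) ⟩
      2 + (V M + E M + F M)            ≡⟨ shift₂ (V M) (E M) (F M) ⟩
      suc (V M) + E M + suc (F M)      ≡⟨ cong₂ (λ v f → v + E M + f) V≡ F≡ ⟨
      V′ + E M + F′                    ∎
  }
  where
  open Spherical
  open ≤-Reasoning
  vertices′ = proj₂ (classes-exist (stepF? σ′))
  faces′ = proj₂ (classes-exist (stepF? (σ′ ∘ α)))
  comps′ = proj₂ (classes-exist (∪ˢ? σ′ α))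
  V′ = proj₁ (classes-exist (stepF? σ′))
  F′ = proj₁ (classes-exist (stepF? (σ′ ∘ α)))
  C′ = proj₁ (classes-exist (∪ˢ? σ′ α))
  V≡ : V′ ≡ suc (V M)
  V≡ = bypass-count injσ p σz≢z (vertices M) vertices′
  F≡ : F′ ≡ suc (F M)
  F≡ = bypass-count (∘-injective injσ injα) (bypass-∘ injα αz p) (λ eq → σz≢z (trans (cong σ (sym αz)) eq)) (faces M) faces′
  apart : ¬ EqClosure (σ′ ∪ˢ α) z (σ z)
  apart r = σz≢z (isolated
    [ (λ eq → bypass-injective injσ p (trans eq (sym (fixed p)))) , (λ eq → injα (trans eq (sym αz))) ]′
    [ (λ eq → trans (sym eq) (fixed p)) , (λ eq → trans (sym eq) αz) ]′ r)
  C≡ : C′ ≡ suc (C M)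
  C≡ with join-unrelated apart comps′
  ... | j , C′≡ , cj = trans C′≡ (cong suc (classes-≡
    (∪-⊑ (∪ˢ-⊑ (λ r → (∪ˢ-left Eq.⋆) (bypass-⊑ p r)) ∪ˢ-right) (∪ˢ-left refl))
    (∪ˢ-⊑ (λ r → (∪-⊑ (λ q → Eq.return (inj₁ (inj₁ q))) pair Eq.⋆) (⊑-bypass p r)) (λ q → Eq.return (inj₁ (inj₂ q))))
    cj (components M)))
  shift₁ : ∀ d c → d + 2 * suc c ≡ 2 + (d + 2 * c)
  shift₁ = solve-∀
  shift₂ : ∀ v e f → 2 + (v + e + f) ≡ suc v + e + suc f
  shift₂ = solve-∀

-- Explicit swaps and bypasses, and the loop over all darts

Involution : (Fin d → Fin d) → Set
Involution α = ∀ x → α (α x) ≡ x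

involution-injective : {α : Fin d → Fin d} → Involution α → Injective _≡_ _≡_ α
involution-injective {α = α} inv {x} {y} eq = trans (sym (inv x)) (trans (cong α eq) (inv y))

transpose-ˡ : ∀ (a b : Fin d) → transpose a b a ≡ b
transpose-ˡ a b with a ≟ a
... | yes _  = refl
... | no neq = contradiction refl neq

transpose-ʳ : ∀ (a b : Fin d) → transpose a b b ≡ a
transpose-ʳ a b with b ≟ a
... | yes b≡a = b≡a
... | no _ with b ≟ b
...   | yes _  = refl
...   | no neq = contradiction refl neq

transpose-≢ : x ≢ a → x ≢ b → transpose a b x ≡ x
transpose-≢ {x = x} {a = a} {b = b} x≢a x≢b with x ≟ a
... | yes eq = contradiction eq x≢a
... | no _ with x ≟ b
...   | yes eq = contradiction eq x≢b
...   | no _   = refl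

transpose-swapped : ∀ (f : Fin d → Fin d) a b → Swapped f (f ∘ transpose a b) a b
transpose-swapped f a b = record
  { atˡ  = cong f (transpose-ˡ a b)
  ; atʳ  = cong f (transpose-ʳ a b)
  ; else = λ p q → cong f (transpose-≢ p q)
  }

transpose-injective : ∀ (a b : Fin d) → Injective _≡_ _≡_ (transpose a b)
transpose-injective a b {x} {y} eq =
  trans (sym (transpose-inverse b a)) (trans (cong (transpose b a) eq) (transpose-inverse b a))

cut : (Fin d → Fin d) → Fin d → Fin d → Fin d
cut α z = α ∘ transpose z (α z)

module Cut {α : Fin d → Fin d} (inv : Involution α) (z : Fin d) where

  swapped : Swapped α (cut α z) z (α z)
  swapped = transpose-swapped α z (α z)

  fixedˡ : cut α z z ≡ z
  fixedˡ = trans (atˡ swapped) (inv z)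

  fixedʳ : cut α z (α z) ≡ α z
  fixedʳ = atʳ swapped

  involutive : Involution (cut α z)
  involutive x = go (x ≟ z) (x ≟ α z)
    where
    go : Dec (x ≡ z) → Dec (x ≡ α z) → cut α z (cut α z x) ≡ x
    go (yes refl) _          = trans (cong (cut α z) fixedˡ) fixedˡ
    go (no _)     (yes refl) = trans (cong (cut α z) fixedʳ) fixedʳ
    go (no x≢z)   (no x≢αz)  = trans (cong (cut α z) (else swapped x≢z x≢αz))
      (trans (else swapped (λ eq → x≢αz (trans (sym (inv x)) (cong α eq))) (x≢z ∘ involution-injective inv)) (inv x))

  fixes : α x ≡ x → cut α z x ≡ x
  fixes {x} αx = go (x ≟ z) (x ≟ α z)
    where
    go : Dec (x ≡ z) → Dec (x ≡ α z) → cut α z x ≡ x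
    go (yes refl) _          = fixedˡ
    go (no _)     (yes refl) = fixedʳ
    go (no x≢z)   (no x≢αz)  = trans (else swapped x≢z x≢αz) αx

bypass : (Fin d → Fin d) → Fin d → Fin d → Fin d
bypass f z x with x ≟ z | f x ≟ z
... | yes _ | _     = z
... | no _  | yes _ = f z
... | no _  | no _  = f x

bypass-is : ∀ (f : Fin d → Fin d) z → Bypass z f (bypass f z)
bypass-is f z = record { fixed = fixed′ ; jump = jump′ ; keep = keep′ }
  where
  fixed′ : bypass f z z ≡ z
  fixed′ with z ≟ z | f z ≟ z
  ... | yes _  | _ = refl
  ... | no neq | _ = contradiction refl neq
  jump′ : ∀ {x} → x ≢ z → f x ≡ z → bypass f z x ≡ f z
  jump′ {x} p q with x ≟ z | f x ≟ z
  ... | yes eq | _      = contradiction eq p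
  ... | no _   | yes _  = refl
  ... | no _   | no neq = contradiction q neq
  keep′ : ∀ {x} → x ≢ z → f x ≢ z → bypass f z x ≡ f x
  keep′ {x} p q with x ≟ z | f x ≟ z
  ... | yes eq | _      = contradiction eq p
  ... | no _   | yes eq = contradiction eq q
  ... | no _   | no _   = refl

-- Identifying `z` with its successor `f z` turns every step of `f` into a step of `g` or into no
-- step at all.
bypass-related : Bypass z f g → f z ≢ z → x ≢ z → y ≢ z → x ∼[ f ] y → x ∼[ g ] y
bypass-related {z = z} {f = f} {g = g} {x = x} {y = y} p fz≢z x≢z y≢z r =
  subst₂ (_∼[ g ]_) (shift-≢ x≢z) (shift-≢ y≢z) (Eq.gfold (Eq.isEquivalence _) shift step r)
  where
  shift : Fin _ → Fin _
  shift w with w ≟ z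
  ... | yes _ = f z
  ... | no _  = w
  shift-≢ : ∀ {w} → w ≢ z → shift w ≡ w
  shift-≢ {w} w≢z with w ≟ z
  ... | yes eq = contradiction eq w≢z
  ... | no _   = refl
  shift-z : shift z ≡ f z
  shift-z with z ≟ z
  ... | yes _  = refl
  ... | no neq = contradiction refl neq
  step : ∀ {v w} → f v ≡ w → shift v ∼[ g ] shift w
  step {v} refl = go (v ≟ z) (f v ≟ z)
    where
    go : Dec (v ≡ z) → Dec (f v ≡ z) → shift v ∼[ g ] shift (f v)
    go (yes refl) _        = subst₂ (_∼[ g ]_) (sym shift-z) (sym (shift-≢ fz≢z)) ε
    go (no v≢z)   (yes eq) = subst₂ (_∼[ g ]_) (sym (shift-≢ v≢z)) (trans (sym shift-z) (cong shift (sym eq)))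
                               (Eq.return (jump p v≢z eq))
    go (no v≢z)   (no ≢z)  = subst₂ (_∼[ g ]_) (sym (shift-≢ v≢z)) (sym (shift-≢ ≢z)) (Eq.return (keep p v≢z ≢z))

-- Common loop of the deletion, the contraction and the removal. `Done` has to persist, since a step
-- at one dart also changes the maps at others.
process-all : {S : Set} (Inv : S → Set) (Done : Fin d → S → Set) →
              (∀ z {s} → Inv s → ∃ λ s′ → Inv s′ × Done z s′ × (∀ {y} → Done y s → Done y s′)) →
              ∀ {s} → Inv s → ∃ λ s′ → Inv s′ × (∀ z → Done z s′)
process-all {d = d} {S} Inv Done step inv₀ with go (allFin d) inv₀
  where
  go : ∀ zs {s} → Inv s → ∃ λ s′ → Inv s′ × All (λ z → Done z s′) zs × (∀ {y} → Done y s → Done y s′)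
  go []       inv = _ , inv , All.[] , id
  go (z ∷ zs) inv with step z inv
  ... | s₁ , inv₁ , done , mono₁ with go zs inv₁
  ...   | s₂ , inv₂ , dones , mono₂ = s₂ , inv₂ , mono₂ done All.∷ dones , mono₂ ∘ mono₁
... | s , inv , dones , _ = s , inv , λ z → All.lookup dones (∈-allFin z)

-- The spherical map of live edges on the blocks

module Reduction {n : ℕ} (G : Graph n) (P : Planar G) (D : Subset n) (m : Fin n → Fin n)
                 (O : IsOwnerAssignment G D m) where
  open Planar P
  open CombinatorialMap plane using (α-involutive; α-fixpointFree)
  open RotationSystem rotation
  open GenusZero genusZero
  open IsOwnerAssignment O

  σ₀ α₀ : Fin darts → Fin darts
  σ₀ = CombinatorialMap.σ plane ⟨$⟩ʳ_
  α₀ = CombinatorialMap.α plane ⟨$⟩ʳ_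

  σ₀-injective : Injective _≡_ _≡_ σ₀
  σ₀-injective {x} {y} eq = trans (sym (Perm.inverseˡ π)) (trans (cong (π Perm.⟨$⟩ˡ_) eq) (Perm.inverseˡ π))
    where π = CombinatorialMap.σ plane

  β h : Fin darts → Fin n
  β x = m (tail x)
  h x = m (head x)

  Big : Fin n → Set
  Big x = x ∉ D × 3 ≤ k G D m x

  big? : ∀ x → Dec (Big x)
  big? x = ¬? (x ∈? D) ×-dec (3 ≤? k G D m x)

  Live : Fin darts → Set
  Live x = β x ≢ h x × (Big (tail x) ⊎ Big (head x))

  live? : ∀ x → Dec (Live x)
  live? x = ¬? (β x ≟ h x) ×-dec (big? (tail x) ⊎-dec big? (head x))

  Spoke : Fin darts → Set
  Spoke x = (tail x ∉ D × head x ≡ m (tail x)) ⊎ (head x ∉ D × tail x ≡ m (head x))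

  spoke? : ∀ x → Dec (Spoke x)
  spoke? x = (¬? (tail x ∈? D) ×-dec (head x ≟ m (tail x))) ⊎-dec (¬? (head x ∈? D) ×-dec (tail x ≟ m (head x)))

  tail-σ₀ : tail (σ₀ x) ≡ tail x
  tail-σ₀ = Equivalence.from same-tail (Eq.symmetric _ (Eq.return refl))

  head-α₀ : head (α₀ x) ≡ tail x
  head-α₀ = cong tail (α-involutive _)

  h-α₀ : h (α₀ x) ≡ β x
  h-α₀ = cong m head-α₀

  live-α₀ : Live x → Live (α₀ x)
  live-α₀ (β≢h , big) = (λ eq → β≢h (trans (sym h-α₀) (sym eq))) ,
    [ (λ p → inj₂ (subst Big (sym head-α₀) p)) , inj₁ ]′ big

  spoke-α₀ : Spoke x → Spoke (α₀ x)
  spoke-α₀ (inj₁ (∉D , eq)) = inj₂ (subst (_∉ D) (sym head-α₀) ∉D , trans eq (cong m (sym head-α₀)))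
  spoke-α₀ (inj₂ (∉D , eq)) = inj₁ (∉D , trans head-α₀ eq)

  m-idem : ∀ v → m (m v) ≡ m v
  m-idem v = owner-fixed (owner-∈ v)

  spoke-β : Spoke x → β x ≡ h x
  spoke-β (inj₁ (_ , eq)) = sym (trans (cong m eq) (m-idem _))
  spoke-β (inj₂ (_ , eq)) = trans (cong m eq) (m-idem _)

  Keep : Fin darts → Set
  Keep x = Live x ⊎ Spoke x

  keep? : ∀ x → Dec (Keep x)
  keep? x = live? x ⊎-dec spoke? x

  keep-α₀ : Keep x → Keep (α₀ x)
  keep-α₀ = [ inj₁ ∘ live-α₀ , inj₂ ∘ spoke-α₀ ]′

  abstract
    -- Orbits of the involution have at most two darts, so `darts ≤ E * 2`; the given Euler formula
    -- then turns one of the two copies of `E` into vertices and faces.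
    spherical₀ : Spherical σ₀ α₀
    spherical₀ = record
      { vertices = vertices ; edges = edges ; faces = faces ; components = components
      ; euler = begin
          darts + 2 * C          ≤⟨ +-monoˡ-≤ (2 * C) darts≤ ⟩
          E * 2 + 2 * C          ≡⟨ shift E C ⟩
          (E + 2 * C) + E        ≡⟨ cong (_+ E) euler ⟨
          (V + F) + E            ≡⟨ swap V F E ⟩
          V + E + F              ∎
      }
      where
      open ≤-Reasoning
      shift : ∀ e c → e * 2 + 2 * c ≡ (e + 2 * c) + e
      shift = solve-∀
      swap : ∀ v f e → (v + f) + e ≡ v + e + f
      swap = solve-∀
      orbit : ∀ {x y} → x ∼[ α₀ ] y → y ≡ x ⊎ y ≡ α₀ x
      orbit ε = inj₁ refl
      orbit (fwd refl ◅ r) = [ inj₂ , (λ eq → inj₁ (trans eq (α-involutive _))) ]′ (orbit r)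
      orbit (bwd refl ◅ r) = [ (λ eq → inj₂ (trans eq (sym (α-involutive _)))) , inj₁ ]′ (orbit r)
      darts≤ : darts ≤ E * 2
      darts≤ = begin
        darts                                                              ≡⟨ trans (sum-const darts 1) (*-identityʳ darts) ⟨
        sum {darts} (λ _ → 1)                                              ≡⟨ sum-fibres (Classes.class edges) (λ _ → 1) ⟩
        sum (λ j → sum (λ x → 𝟙 (Classes.class edges x ≟ j) * 1))          ≤⟨ sum-mono small ⟩
        sum {E} (λ _ → 2)                                                  ≡⟨ sum-const E 2 ⟩
        E * 2                                                              ∎
        where
        small : ∀ j → sum (λ x → 𝟙 (Classes.class edges x ≟ j) * 1) ≤ 2
        small j with Classes.surjective edges j
        ... | r , refl = begin
          sum (λ x → 𝟙 (Classes.class edges x ≟ Classes.class edges r) * 1)  ≤⟨ sum-mono two ⟩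
          sum (λ x → 𝟙 (r ≟ x) * 1 + 𝟙 (α₀ r ≟ x) * 1)                       ≡⟨ ∑-distrib-+ (λ x → 𝟙 (r ≟ x) * 1) (λ x → 𝟙 (α₀ r ≟ x) * 1) ⟩
          sum (λ x → 𝟙 (r ≟ x) * 1) + sum (λ x → 𝟙 (α₀ r ≟ x) * 1)           ≡⟨ cong₂ _+_ (sum-δ (λ _ → 1) r) (sum-δ (λ _ → 1) (α₀ r)) ⟩
          2                                                                  ∎
          where
          two : ∀ x → 𝟙 (Classes.class edges x ≟ Classes.class edges r) * 1 ≤ 𝟙 (r ≟ x) * 1 + 𝟙 (α₀ r ≟ x) * 1
          two x with Classes.class edges x ≟ Classes.class edges r
          ... | no _ = z≤n
          ... | yes eq with orbit (relate edges (sym eq))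
          ...   | inj₁ refl = ≤-trans (≤-reflexive (cong (_* 1) (sym (𝟙-yes (r ≟ r) refl)))) (m≤m+n _ _)
          ...   | inj₂ refl = ≤-trans (≤-reflexive (cong (_* 1) (sym (𝟙-yes (α₀ r ≟ α₀ r) refl)))) (m≤n+m _ _)

  -- Deletion of the edges that are neither live nor spokes

  record Deleted (α′ : Fin darts → Fin darts) : Set where
    field
      involutive : Involution α′
      sub        : ∀ x → α′ x ≡ x ⊎ α′ x ≡ α₀ x
      kept       : Keep x → α′ x ≡ α₀ x
      spherical  : Spherical σ₀ α′

  abstract
    delete : ∃ λ α′ → Deleted α′ × (∀ z → Keep z ⊎ α′ z ≡ z)
    delete = process-all Deleted (λ z α′ → Keep z ⊎ α′ z ≡ z) step record
      { involutive = α-involutive ; sub = λ _ → inj₂ refl ; kept = λ _ → refl ; spherical = spherical₀ }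
      where
      step : ∀ z {α′} → Deleted α′ → ∃ λ α″ → Deleted α″ × (Keep z ⊎ α″ z ≡ z) ×
             (∀ {y} → Keep y ⊎ α′ y ≡ y → Keep y ⊎ α″ y ≡ y)
      step z {α′} I with keep? z | α′ z ≟ z
      ... | yes kz | _       = α′ , I , inj₁ kz , id
      ... | no _   | yes fix = α′ , I , inj₂ fix , id
      ... | no ¬kz | no move = cut α′ z , record
        { involutive = involutive′
        ; sub        = sub′
        ; kept       = λ {x} kx → trans (else swapped (λ { refl → ¬kz kx })
            (λ { refl → ¬kz (subst Keep back (keep-α₀ kx)) })) (kept kx)
        ; spherical  = delete-edge σ₀-injective (involution-injective involutive′) swapped (move ∘ sym) fixedˡ fixedʳ spherical
        } , inj₂ fixedˡ , [ inj₁ , inj₂ ∘ fixes ]′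
        where
        open Deleted I
        open Cut {α = α′} involutive z renaming (involutive to involutive′)
        α′z : α′ z ≡ α₀ z
        α′z = [ (λ eq → contradiction eq move) , id ]′ (sub z)
        back : α₀ (α′ z) ≡ z
        back = trans (cong α₀ α′z) (α-involutive z)
        sub′ : ∀ x → cut α′ z x ≡ x ⊎ cut α′ z x ≡ α₀ x
        sub′ x = go (x ≟ z) (x ≟ α′ z)
          where
          go : Dec (x ≡ z) → Dec (x ≡ α′ z) → cut α′ z x ≡ x ⊎ cut α′ z x ≡ α₀ x
          go (yes refl) _          = inj₁ fixedˡ
          go (no _)     (yes refl) = inj₁ fixedʳ
          go (no p)     (no q)     = [ inj₁ ∘ trans (else swapped p q) , inj₂ ∘ trans (else swapped p q) ]′ (sub x)

  α₁ : Fin darts → Fin darts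
  α₁ = proj₁ delete

  open Deleted (proj₁ (proj₂ delete)) using () renaming (involutive to α₁-involutive; kept to α₁-kept; spherical to spherical₁)

  α₁-dropped : ¬ Keep x → α₁ x ≡ x
  α₁-dropped ¬k = [ (λ k → contradiction k ¬k) , id ]′ (proj₂ (proj₂ delete) _)

  -- Contraction of the spokes

  record Contracted (s : (Fin darts → Fin darts) × (Fin darts → Fin darts)) : Set where
    σ = proj₁ s
    α = proj₂ s
    field
      injective  : Injective _≡_ _≡_ σ
      involutive : Involution α
      -- Each spoke is contracted once and affects only its own two darts, so `σ` has an explicit
      -- value throughout: at a contracted spoke the rotation continues behind the opposite dart.
      status     : ∀ x → (α x ≡ α₁ x × σ x ≡ σ₀ x) ⊎ (Spoke x × α x ≡ x × σ x ≡ σ₀ (α₀ x))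
      σ₀-related : ∀ x → σ₀ x ∼[ σ ] x
      α₀-related : Spoke x → α x ≡ x → α₀ x ∼[ σ ] x
      spherical  : Spherical σ α

    -- The spoke to the owner is the only spoke at a vertex outside `D`. While it is uncontracted,
    -- no dart of that vertex has been redirected.
    tail-leaf : tail z ∉ D → head z ≡ m (tail z) → α z ≢ z → tail x ≡ tail z → tail (σ x) ≡ tail z
    tail-leaf {z} {x} ∉D hz αz≢z tx with status x
    ... | inj₁ (_ , σx) = trans (cong tail σx) (trans tail-σ₀ tx)
    ... | inj₂ (inj₁ (_ , hx) , αx , _) = contradiction
      (subst (λ w → α w ≡ w) (simple tx (trans hx (trans (cong m tx) (sym hz)))) αx) αz≢z
    ... | inj₂ (inj₂ (_ , tx′) , _ , _) = contradiction (subst (Sub._∈ D) (trans (sym tx′) tx) (owner-∈ _)) ∉D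

    leaf-orbit : tail z ∉ D → head z ≡ m (tail z) → α z ≢ z → z ∼[ σ ] y → tail y ≡ tail z
    leaf-orbit {z} ∉D hz αz≢z r with orbit-iter injective r
    ... | i , refl = go i refl
      where
      go : ∀ i {x} → tail x ≡ tail z → tail (iter σ i x) ≡ tail z
      go zero    eq = eq
      go (suc i) eq = go i (tail-leaf ∉D hz αz≢z eq)

    -- The spokes form stars centred in `D`. The outer end of an uncontracted spoke is still a leaf,
    -- with an orbit made of its own darts only, whereas the other end starts in `D`; so contraction
    -- never meets a loop.
    spoke-unrelated : Spoke z → α z ≡ α₀ z → ¬ z ∼[ σ ] α₀ z
    spoke-unrelated (inj₁ (∉D , hz)) αz r = ∉D (subst (Sub._∈ D)
      (trans (sym hz) (leaf-orbit ∉D hz (λ eq → α-fixpointFree _ (trans (sym αz) eq)) r)) (owner-∈ _))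
    spoke-unrelated {z} (inj₂ (∉D , tz)) αz r = ∉D (subst (Sub._∈ D)
      (trans (sym tz) (leaf-orbit ∉D (trans head-α₀ tz) moved (eq-sym r))) (owner-∈ _))
      where
      moved : α (α₀ z) ≢ α₀ z
      moved eq = α-fixpointFree z (trans (sym eq) (trans (cong α (sym αz)) (involutive z)))

  spoke-moves : Spoke z → α₁ z ≢ z
  spoke-moves sz eq = α-fixpointFree _ (trans (sym (α₁-kept (inj₂ sz))) eq)

  abstract
    contract : ∃ λ s → Contracted s × (∀ z → Spoke z → proj₂ s z ≡ z)
    contract = process-all Contracted (λ z s → Spoke z → proj₂ s z ≡ z) step {s = σ₀ , α₁} record
      { injective  = σ₀-injective
      ; involutive = α₁-involutive
      ; status     = λ _ → inj₁ (refl , refl)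
      ; σ₀-related = λ _ → eq-sym (Eq.return refl)
      ; α₀-related = λ sx eq → contradiction eq (spoke-moves sx)
      ; spherical  = spherical₁
      }
      where
      step : ∀ z {s} → Contracted s → ∃ λ s′ → Contracted s′ × (Spoke z → proj₂ s′ z ≡ z) ×
             (∀ {y} → (Spoke y → proj₂ s y ≡ y) → (Spoke y → proj₂ s′ y ≡ y))
      step z {s} I with spoke? z | proj₂ s z ≟ z
      ... | no ¬sz | _       = s , I , (λ sz → contradiction sz ¬sz) , id
      ... | yes _  | yes fix = s , I , (λ _ → fix) , id
      ... | yes sz | no move = (σ ∘ transpose z (α z) , cut α z) , record
        { injective  = ∘-injective injective (transpose-injective z (α z))
        ; involutive = involutive′
        ; status     = λ x → status′ x (x ≟ z) (x ≟ α z)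
        ; σ₀-related = λ x → lift (σ₀-related x)
        ; α₀-related = λ {x} sx eq → α₀-related′ sx eq (x ≟ z) (x ≟ α z)
        ; spherical  = contract-edge injective (involution-injective involutive′) swappedσ swapped ¬r fixedˡ fixedʳ spherical
        } , (λ _ → fixedˡ) , (λ f sy → fixes (f sy))
        where
        open Contracted I
        open Cut {α = α} involutive z renaming (involutive to involutive′)
        swappedσ : Swapped σ (σ ∘ transpose z (α z)) z (α z)
        swappedσ = transpose-swapped σ z (α z)
        not-moved : ∀ {x} → α x ≢ x → α x ≡ α₁ x × σ x ≡ σ₀ x
        not-moved {x} αx≢x = [ id , (λ (_ , αx , _) → contradiction αx αx≢x) ]′ (status x)
        αz : α z ≡ α₀ z
        αz = trans (proj₁ (not-moved move)) (α₁-kept (inj₂ sz))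
        ¬r : ¬ z ∼[ σ ] α z
        ¬r r = spoke-unrelated sz αz (subst (z ∼[ σ ]_) αz r)
        lift : ∀ {x y} → x ∼[ σ ] y → x ∼[ σ ∘ transpose z (α z) ] y
        lift r = ((λ q → (∪-⊑ Eq.return (swapped-merges injective swappedσ ¬r) Eq.⋆) (swapped-⊑ (swapped-sym swappedσ) q)) Eq.⋆) r
        merged : z ∼[ σ ∘ transpose z (α z) ] α z
        merged = swapped-merges injective swappedσ ¬r
        α₀αz : α₀ (α z) ≡ z
        α₀αz = trans (cong α₀ αz) (α-involutive z)
        status′ : ∀ x → Dec (x ≡ z) → Dec (x ≡ α z) →
                  (cut α z x ≡ α₁ x × σ (transpose z (α z) x) ≡ σ₀ x) ⊎
                  (Spoke x × cut α z x ≡ x × σ (transpose z (α z) x) ≡ σ₀ (α₀ x))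
        status′ x (yes refl) _ = inj₂ (sz , fixedˡ , trans (atˡ swappedσ)
          (trans (proj₂ (not-moved λ eq → move (trans (sym eq) (involutive z)))) (cong σ₀ αz)))
        status′ x (no _) (yes refl) = inj₂ (subst Spoke (sym αz) (spoke-α₀ sz) , fixedʳ , trans (atʳ swappedσ)
          (trans (proj₂ (not-moved move)) (cong σ₀ (sym α₀αz))))
        status′ x (no p) (no q) with status x
        ... | inj₁ (αx , σx)      = inj₁ (trans (else swapped p q) αx , trans (else swappedσ p q) σx)
        ... | inj₂ (sx , αx , σx) = inj₂ (sx , trans (else swapped p q) αx , trans (else swappedσ p q) σx)
        α₀-related′ : ∀ {x} → Spoke x → cut α z x ≡ x → Dec (x ≡ z) → Dec (x ≡ α z) → α₀ x ∼[ σ ∘ transpose z (α z) ] x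
        α₀-related′ sx eq (yes refl) _ = subst (_∼[ σ ∘ transpose z (α z) ] z) αz (eq-sym merged)
        α₀-related′ sx eq (no _) (yes refl) = subst (_∼[ σ ∘ transpose z (α z) ] α z) (sym α₀αz) merged
        α₀-related′ sx eq (no p) (no q) = lift (α₀-related sx (trans (sym (else swapped p q)) eq))

  open Contracted (proj₁ (proj₂ contract)) using (status) renaming
    (σ to σ₂; α to α₂; injective to σ₂-injective; involutive to α₂-involutive; σ₀-related to σ₀-related₂; spherical to spherical₂) public

  α₀-related₂ : Spoke x → α₀ x ∼[ σ₂ ] x
  α₀-related₂ sx = Contracted.α₀-related (proj₁ (proj₂ contract)) sx (proj₂ (proj₂ contract) _ sx)

  α₂-live : Live x → α₂ x ≡ α₀ x
  α₂-live {x} live with status x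
  ... | inj₁ (αx , _)   = trans αx (α₁-kept (inj₁ live))
  ... | inj₂ (sx , _ )  = contradiction (spoke-β sx) (proj₁ live)

  α₂-dead : ¬ Live x → α₂ x ≡ x
  α₂-dead {x} ¬live with status x | spoke? x
  ... | _              | yes sx = proj₂ (proj₂ contract) _ sx
  ... | inj₂ (sx , _)  | no ¬sx = contradiction sx ¬sx
  ... | inj₁ (αx , _)  | no ¬sx = trans αx (α₁-dropped [ ¬live , ¬sx ]′)

  β-σ₂ : β (σ₂ x) ≡ β x
  β-σ₂ {x} with status x
  ... | inj₁ (_ , σx)      = cong m (trans (cong tail σx) tail-σ₀)
  ... | inj₂ (sx , _ , σx) = trans (cong m (trans (cong tail σx) tail-σ₀)) (sym (spoke-β sx))

  -- The rotation leaves a vertex only at a contracted spoke, and a vertex outside `D` has just the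
  -- one to its owner.
  exit₂ : tail x ∉ D → tail x ≡ tail y → tail (σ₂ x) ≢ tail x → tail (σ₂ y) ≢ tail y → x ≡ y
  exit₂ {x} {y} ∉D tx≡ty ex ey with status x | status y
  ... | inj₁ (_ , σx)                | _                            = contradiction (trans (cong tail σx) tail-σ₀) ex
  ... | _                            | inj₁ (_ , σy)                = contradiction (trans (cong tail σy) tail-σ₀) ey
  ... | inj₂ (inj₂ (_ , tx) , _)     | _                            = contradiction (subst (Sub._∈ D) (sym tx) (owner-∈ _)) ∉D
  ... | _                            | inj₂ (inj₂ (_ , ty) , _)     = contradiction (subst (Sub._∈ D) (sym (trans tx≡ty ty)) (owner-∈ _)) ∉D
  ... | inj₂ (inj₁ (_ , hx) , _)     | inj₂ (inj₁ (_ , hy) , _)     = simple tx≡ty (trans hx (trans (cong m tx≡ty) (sym hy)))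

  tail-related₂ : tail x ≡ tail y → x ∼[ σ₂ ] y
  tail-related₂ eq = ((λ { refl → eq-sym (σ₀-related₂ _) }) Eq.⋆) (Equivalence.to same-tail eq)

  -- A dart at the owner is the common reference point of a block; from a vertex outside `D` it is
  -- reached across the contracted spoke.
  centred : ∀ x → ∃ λ y → x ∼[ σ₂ ] y × tail y ≡ β x
  centred x with tail x ∈? D
  ... | yes ∈D = x , ε , sym (owner-fixed ∈D)
  ... | no ∉D with complete (owner-adj ∉D)
  ...   | s , ts , hs = α₀ s , tail-related₂ (sym ts) ◅◅ eq-sym (α₀-related₂ spoke) , hs
    where
    spoke : Spoke s
    spoke = inj₁ (subst (_∉ D) (sym ts) ∉D , trans hs (cong m (sym ts)))

  block-related₂ : β x ≡ β y → x ∼[ σ₂ ] y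
  block-related₂ {x} {y} eq with centred x | centred y
  ... | x′ , rx , tx | y′ , ry , ty = rx ◅◅ tail-related₂ (trans tx (trans eq (sym ty))) ◅◅ eq-sym ry

  -- Removal of the dead darts from the rotation

  record Reduced (σ : Fin darts → Fin darts) : Set where
    field
      injective     : Injective _≡_ _≡_ σ
      β-σ           : β (σ x) ≡ β x
      -- Only for live darts: a removed dart is a fixed point of `σ` and has left the orbit of its
      -- block.
      block-related : Live x → Live y → β x ≡ β y → x ∼[ σ ] y
      -- the darts of a vertex outside D are consecutive in their σ-orbit
      exit-unique   : tail x ∉ D → tail x ≡ tail y → tail (σ x) ≢ tail x → tail (σ y) ≢ tail y → x ≡ y
      spherical     : Spherical σ α₂

  abstract
    reduce : ∃ λ σ → Reduced σ × (∀ z → Live z ⊎ σ z ≡ z)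
    reduce = process-all Reduced (λ z σ → Live z ⊎ σ z ≡ z) step {s = σ₂} record
      { injective = σ₂-injective ; β-σ = β-σ₂ ; block-related = λ _ _ → block-related₂ ; exit-unique = exit₂ ; spherical = spherical₂ }
      where
      step : ∀ z {σ} → Reduced σ → ∃ λ σ′ → Reduced σ′ × (Live z ⊎ σ′ z ≡ z) ×
             (∀ {y} → Live y ⊎ σ y ≡ y → Live y ⊎ σ′ y ≡ y)
      step z {σ} I with live? z | σ z ≟ z
      ... | yes lz | _       = σ , I , inj₁ lz , id
      ... | no _   | yes fix = σ , I , inj₂ fix , id
      ... | no ¬lz | no move = σ′ , record
        { injective     = bypass-injective injective p
        ; β-σ           = λ {x} → β-σ′ (x ≟ z) (σ x ≟ z)
        ; block-related = λ lx ly eq → bypass-related p move (λ { refl → ¬lz lx }) (λ { refl → ¬lz ly }) (block-related lx ly eq)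
        ; exit-unique   = exit′
        ; spherical     = remove-mark injective (involution-injective α₂-involutive) p move (α₂-dead ¬lz) spherical
        } , inj₂ (fixed p) , λ {y} → [ inj₁ , inj₂ ∘ still (y ≟ z) ]′
        where
        open Reduced I
        σ′ : Fin darts → Fin darts
        σ′ = bypass σ z
        p : Bypass z σ σ′
        p = bypass-is σ z
        β-σ′ : ∀ {x} → Dec (x ≡ z) → Dec (σ x ≡ z) → β (σ′ x) ≡ β x
        β-σ′ (yes refl) _        = cong β (fixed p)
        β-σ′ (no x≢z)   (yes σx) = trans (cong β (jump p x≢z σx)) (trans β-σ (trans (cong β (sym σx)) β-σ))
        β-σ′ (no x≢z)   (no ≢z)  = trans (cong β (keep p x≢z ≢z)) β-σ
        still : ∀ {y} → Dec (y ≡ z) → σ y ≡ y → σ′ y ≡ y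
        still (yes refl) _  = fixed p
        still (no y≢z)   σy = trans (keep p y≢z (λ eq → y≢z (trans (sym σy) eq))) σy
        not-z : ∀ {x} → tail (σ′ x) ≢ tail x → x ≢ z
        not-z ex refl = ex (cong tail (fixed p))
        -- Bypassing `z` creates an exit only by handing the exit of `z` to its predecessor at the
        -- same vertex, so exits remain unique.
        exit-source : ∀ {x} → tail (σ′ x) ≢ tail x →
                      tail (σ x) ≢ tail x ⊎ (σ x ≡ z × tail z ≡ tail x × tail (σ z) ≢ tail z)
        exit-source {x} ex = go (σ x ≟ z) (tail z ≟ tail x)
          where
          go : Dec (σ x ≡ z) → Dec (tail z ≡ tail x) →
               tail (σ x) ≢ tail x ⊎ (σ x ≡ z × tail z ≡ tail x × tail (σ z) ≢ tail z)
          go (no ≢z)  _           = inj₁ λ eq → ex (trans (cong tail (keep p (not-z ex) ≢z)) eq)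
          go (yes σx) (no tz≢tx)  = inj₁ λ eq → tz≢tx (trans (cong tail (sym σx)) eq)
          go (yes σx) (yes tz≡tx) = inj₂ (σx , tz≡tx , λ eq → ex (trans (cong tail (jump p (not-z ex) σx)) (trans eq tz≡tx)))
        exit′ : ∀ {x y} → tail x ∉ D → tail x ≡ tail y → tail (σ′ x) ≢ tail x → tail (σ′ y) ≢ tail y → x ≡ y
        exit′ ∉D eq ex ey with exit-source ex | exit-source ey
        ... | inj₁ ex′ | inj₁ ey′ = exit-unique ∉D eq ex′ ey′
        ... | inj₂ (σx , tz , ez) | inj₂ (σy , _ , _) = injective (trans σx (sym σy))
        ... | inj₁ ex′ | inj₂ (σy , tz , ez) = contradiction (exit-unique ∉D (trans eq (sym tz)) ex′ ez) (not-z ex)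
        ... | inj₂ (σx , tz , ez) | inj₁ ey′ = contradiction (exit-unique (subst (_∉ D) eq ∉D) (trans (sym eq) (sym tz)) ey′ ez) (not-z ey)

-- Discharging

-- A discrete intermediate value argument for walks around a block; `I` carries membership in the
-- block along.
first-exit : {I Q : Fin d → Set} → (∀ y → Dec (Q y)) → (∀ {y} → I y → I (f y)) →
             ∀ i {x} → I x → Q x → ¬ Q (iter f i x) → ∃ λ y → I y × Q y × ¬ Q (f y)
first-exit Q? closed zero    Ix Qx ¬Q = contradiction Qx ¬Q
first-exit {f = f} Q? closed (suc i) {x} Ix Qx ¬Q with Q? (f x)
... | yes Qfx = first-exit Q? closed i (closed Ix) Qfx ¬Q
... | no ¬Qfx = x , Ix , Qx , ¬Qfx

iter-closed : (I : Fin d → Set) → (∀ {y} → I y → I (f y)) → ∀ i {x} → I x → I (iter f i x)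
iter-closed I closed zero    Ix = Ix
iter-closed I closed (suc i) Ix = iter-closed I closed i (closed Ix)

∈-comprehension : ∀ {n} {Q : Fin n → Set} (Q? : ∀ v → Dec (Q v)) {v} → v Sub.∈ ⟪ Q? ⟫ → Q v
∈-comprehension Q? {v} v∈ with Q? v | trans (sym (lookup∘tabulate (λ v → Dec.does (Q? v)) v)) ([]=⇒lookup v∈)
... | yes q | _ = q
... | no _  | ()

another-member : ∀ {n} (p : Subset n) → 2 ≤ ∣ p ∣ → ∀ l → ∃ λ j → j Sub.∈ p × j ≢ l
another-member p 2≤ l with any? (λ j → (j ∈? p) ×-dec ¬? (j ≟ l))
... | yes found = found
... | no none = contradiction (≤-trans 2≤ (≤-trans (≤-reflexive (∣p∣≡sum p))
    (sum-at-most-one (_∈? p) (yes l) (λ i∈ j∈ → trans (only i∈) (sym (only j∈))) (λ _ → l)))) λ { (s≤s ()) }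
  where
  only : ∀ {j} → j Sub.∈ p → j ≡ l
  only {j} j∈ = decidable-stable (j ≟ l) λ j≢l → none (j , j∈ , j≢l)

module Discharging {n : ℕ} (G : Graph n) (P : Planar G) (D : Subset n) (m : Fin n → Fin n)
                   (O : IsOwnerAssignment G D m) where
  open Reduction G P D m O
  open Graph G using (adj?)
  open Planar P using (darts; rotation)
  open RotationSystem rotation
  open IsOwnerAssignment O

  private
    variable
      c l v : Fin n

  σ α φ : Fin darts → Fin darts
  σ = proj₁ reduce
  α = α₂
  φ x = σ (α x)

  open Reduced (proj₁ (proj₂ reduce))

  α-involutive : Involution α
  α-involutive = α₂-involutive

  α-injective : Injective _≡_ _≡_ α
  α-injective = involution-injective α-involutive

  φ-injective : Injective _≡_ _≡_ φ
  φ-injective = ∘-injective injective α-injective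

  σ-dead : ¬ Live x → σ x ≡ x
  σ-dead ¬live = [ (λ live → contradiction live ¬live) , id ]′ (proj₂ (proj₂ reduce) _)

  live-σ : Live x → Live (σ x)
  live-σ {x} live with live? (σ x)
  ... | yes live′ = live′
  ... | no ¬live  = contradiction (subst Live (sym (injective (σ-dead ¬live))) live) ¬live

  live-α : Live x → Live (α x)
  live-α live = subst Live (sym (α₂-live live)) (live-α₀ live)

  live-φ : Live x → Live (φ x)
  live-φ live = live-σ (live-α live)

  β-α : Live x → β (α x) ≡ h x
  β-α live = cong β (α₂-live live)

  h-α : Live x → h (α x) ≡ β x
  h-α live = trans (cong h (α₂-live live)) h-α₀

  β-φ : Live x → β (φ x) ≡ h x
  β-φ live = trans β-σ (β-α live)

  φ-moves : Live x → φ x ≢ x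
  φ-moves live eq = proj₁ live (trans (cong β (sym eq)) (β-φ live))

  α-moves : Live x → α x ≢ x
  α-moves live eq = proj₁ live (trans (cong β (sym eq)) (β-α live))

  block-iter : Live x → Live y → β x ≡ β y → ∃ λ i → iter σ i x ≡ y
  block-iter lx ly eq = orbit-iter injective (block-related lx ly eq)

  -- Turns around a block

  InBlock : Fin n → Fin darts → Set
  InBlock c x = Live x × β x ≡ c

  in-block-σ : InBlock c x → InBlock c (σ x)
  in-block-σ (live , eq) = live-σ live , trans β-σ eq

  big-dart : Big v → l Sub.∈ C-out G D m v → ∃ λ a → Live a × tail a ≡ v × h a ≡ l
  big-dart {v} {l} big l∈ with ∈-comprehension (λ c → (c ∈? D) ×-dec ¬? (c ≟ m v) ×-dec nonempty? (N G v ∩ block G D m c)) l∈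
  ... | _ , l≢ , y , y∈ with x∈p∩q⁻ (N G v) (block G D m l) y∈
  ...   | y∈N , y∈B with complete (∈-comprehension (adj? v) y∈N) | ∈-comprehension (λ x → m x ≟ l) y∈B
  ...     | a , refl , refl | refl = a , ((l≢ ∘ sym) , inj₁ big) , refl , refl

  big-labels : Big v → ∀ l → ∃ λ a → Live a × tail a ≡ v × h a ≢ l
  big-labels {v} big l with another-member (C-out G D m v) (≤-trans (s≤s (s≤s z≤n)) (proj₂ big)) l
  ... | j , j∈ , j≢l with big-dart big j∈
  ...   | a , live , ta , refl = a , live , ta , j≢l

  BigBlock : Fin n → Set
  BigBlock c = ∃ λ v → Big v × m v ≡ c

  bigBlock? : ∀ c → Dec (BigBlock c)
  bigBlock? c = any? λ v → big? v ×-dec (m v ≟ c)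

  excess : Fin n → ℕ
  excess v = 𝟙 (¬? (v ∈? D)) * (k G D m v ∸ 2)

  excess-small : ¬ Big v → excess v ≡ 0
  excess-small {v} ¬big with v ∈? D
  ... | yes _  = refl
  ... | no v∉D = trans (*-identityˡ _) (m≤n⇒m∸n≡0 (≤-pred (≰⇒> λ 3≤k → ¬big (v∉D , 3≤k))))

  -- The corner between a and σ a; FaceTurn below names it by the dart α a, which enters it along a face.
  Turn : Fin darts → Set
  Turn a = Live a × h a ≢ h (σ a)

  turn? : ∀ a → Dec (Turn a)
  turn? a = live? a ×-dec ¬? (h a ≟ h (σ a))

  turns : Fin n → ℕ
  turns c = sum λ a → 𝟙 (β a ≟ c) * 𝟙 (turn? a)

  -- On the walk around the block from `a` to `b` the label `h a` is given up somewhere, at a dart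
  -- that still carries it. Different labels therefore yield different turns.
  turn-with-label : InBlock c a → InBlock c b → h a ≢ h b → ∃ λ y → Turn y × β y ≡ c × h y ≡ h a
  turn-with-label {c} {a} {b} ia ib neq with block-iter (proj₁ ia) (proj₁ ib) (trans (proj₂ ia) (sym (proj₂ ib)))
  ... | i , refl with first-exit {I = InBlock c} {Q = λ y → h y ≡ h a} (λ y → h y ≟ h a) in-block-σ i ia refl (neq ∘ sym)
  ...   | y , (live , βy) , hy , ≢a = y , (live , λ eq → ≢a (trans (sym eq) hy)) , βy , hy

  turn-count : ∀ c → sum (λ a → 𝟙 ((β a ≟ c) ×-dec turn? a)) ≤ turns c
  turn-count c = sum-mono λ a → go a (β a ≟ c) (turn? a)
    where
    go : ∀ a (p : Dec (β a ≡ c)) (q : Dec (Turn a)) → 𝟙 (p ×-dec q) ≤ 𝟙 p * 𝟙 q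
    go a (yes _) (yes _) = ≤-refl
    go a (yes _) (no _)  = z≤n
    go a (no _)  _       = z≤n

  k≤turns : Big v → k G D m v ≤ turns (m v)
  k≤turns {v} big = ≤-trans (≤-reflexive (∣p∣≡sum (C-out G D m v))) (≤-trans
    (count-≤ (_∈? C-out G D m v) (λ a → (β a ≟ m v) ×-dec turn? a) (λ l a → h a ≟ l) total
      (λ _ _ p q → trans (sym p) q))
    (turn-count (m v)))
    where
    total : l Sub.∈ C-out G D m v → ∃ λ a → (β a ≡ m v × Turn a) × h a ≡ l
    total l∈ with big-dart big l∈
    ... | a , la , ta , refl with big-labels big (h a)
    ...   | b , lb , tb , neq with turn-with-label (la , cong m ta) (lb , cong m tb) (neq ∘ sym)
    ...     | y , turn , βy , hy = y , (βy , turn) , hy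

  turnsAt : Fin n → ℕ
  turnsAt v = sum λ a → 𝟙 (tail a ≟ v) * 𝟙 (turn? a)

  -- For every label seen from `v`, the walk to a dart of `v` with another label must give up the
  -- label or leave `v`. The dart where this happens is a turn at `v` or the exit from `v`; the exit
  -- is unique and costs the 1.
  k≤turnsAt+1 : Big v → k G D m v ≤ turnsAt v + 1
  k≤turnsAt+1 {v} big = begin
    k G D m v                                                   ≡⟨ ∣p∣≡sum (C-out G D m v) ⟩
    sum (λ l → 𝟙 (l ∈? C-out G D m v))                          ≤⟨ count-≤ (_∈? C-out G D m v) last? (λ l a → h a ≟ l) total (λ _ _ p q → trans (sym p) q) ⟩
    sum (λ a → 𝟙 (last? a))                                     ≤⟨ sum-mono (λ a → split a (tail a ≟ v) (exit? a) (turn? a) (last? a)) ⟩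
    sum (λ a → 𝟙 (tail a ≟ v) * 𝟙 (turn? a) + 𝟙 (exit? a))      ≡⟨ ∑-distrib-+ (λ a → 𝟙 (tail a ≟ v) * 𝟙 (turn? a)) (λ a → 𝟙 (exit? a)) ⟩
    turnsAt v + sum (λ a → 𝟙 (exit? a))                         ≤⟨ +-monoʳ-≤ (turnsAt v) (sum-at-most-one exit? (yes v) one (λ _ → v)) ⟩
    turnsAt v + 1                                               ∎
    where
    open ≤-Reasoning
    Exit Last : Fin darts → Set
    Exit a = tail a ≡ v × tail (σ a) ≢ tail a
    Last a = tail a ≡ v × (Exit a ⊎ Turn a)
    exit? : ∀ a → Dec (Exit a)
    exit? a = (tail a ≟ v) ×-dec ¬? (tail (σ a) ≟ tail a)
    last? : ∀ a → Dec (Last a)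
    last? a = (tail a ≟ v) ×-dec (exit? a ⊎-dec turn? a)
    one : Exit x → Exit y → x ≡ y
    one (refl , ex) (ty , ey) = exit-unique (proj₁ big) (sym ty) ex ey
    split : ∀ a (p : Dec (tail a ≡ v)) (q : Dec (Exit a)) (r : Dec (Turn a)) (s : Dec (Last a)) → 𝟙 s ≤ 𝟙 p * 𝟙 r + 𝟙 q
    split a p q r (no _) = z≤n
    split a p q r (yes (ta , inj₁ ex)) = ≤-trans (≤-reflexive (sym (𝟙-yes q ex))) (m≤n+m _ _)
    split a p q r (yes (ta , inj₂ tu)) = ≤-trans (≤-reflexive (sym (cong₂ _*_ (𝟙-yes p ta) (𝟙-yes r tu)))) (m≤m+n _ _)
    total : l Sub.∈ C-out G D m v → ∃ λ a → Last a × h a ≡ l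
    total l∈ with big-dart big l∈
    ... | a , la , ta , refl with big-labels big (h a)
    ...   | b , lb , tb , neq with block-iter la lb (cong m (trans ta (sym tb)))
    ...     | i , refl with first-exit {I = InBlock (m v)} {Q = λ y → tail y ≡ v × h y ≡ h a}
                              (λ y → (tail y ≟ v) ×-dec (h y ≟ h a)) in-block-σ i (la , cong m ta) (ta , refl) (neq ∘ proj₂)
    ...       | y , (ly , _) , (ty , hy) , ¬Q with tail (σ y) ≟ tail y
    ...         | no ex  = y , (ty , inj₁ (ty , ex)) , hy
    ...         | yes te = y , (ty , inj₂ (ly , λ eq → ¬Q (trans te ty , trans (sym eq) hy))) , hy

  excess≤turnsAt : ∀ v → excess v + 𝟙 (big? v) ≤ turnsAt v
  excess≤turnsAt v = go (big? v)
    where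
    go : (p : Dec (Big v)) → excess v + 𝟙 p ≤ turnsAt v
    go (no ¬big)  = ≤-trans (≤-reflexive (trans (+-identityʳ _) (excess-small ¬big))) z≤n
    go (yes big) = ≤-pred (begin
      suc (excess v + 1)                        ≤⟨ s≤s (+-monoˡ-≤ 1 (*-monoˡ-≤ _ (𝟙≤1 (¬? (v ∈? D))))) ⟩
      suc (1 * (k G D m v ∸ 2) + 1)             ≡⟨ cong (λ e → suc (e + 1)) (*-identityˡ _) ⟩
      suc (k G D m v ∸ 2 + 1)                   ≡⟨ +-suc (k G D m v ∸ 2) 1 ⟨
      k G D m v ∸ 2 + 2                         ≡⟨ m∸n+n≡m (≤-trans (s≤s (s≤s z≤n)) (proj₂ big)) ⟩
      k G D m v                                 ≤⟨ k≤turnsAt+1 big ⟩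
      turnsAt v + 1                             ≡⟨ +-comm (turnsAt v) 1 ⟩
      suc (turnsAt v)                           ∎)
      where open ≤-Reasoning

  blockExcess : Fin n → ℕ
  blockExcess c = sum λ v → 𝟙 (m v ≟ c) * excess v

  sum-turnsAt : ∀ c → sum (λ v → 𝟙 (m v ≟ c) * turnsAt v) ≤ turns c
  sum-turnsAt c = begin
    sum (λ v → 𝟙 (m v ≟ c) * turnsAt v)                            ≤⟨ sum-mono (λ v → go v (m v ≟ c)) ⟩
    sum (λ v → sum λ a → 𝟙 (tail a ≟ v) * (𝟙 (β a ≟ c) * 𝟙 (turn? a)))  ≡⟨ sum-fibres tail (λ a → 𝟙 (β a ≟ c) * 𝟙 (turn? a)) ⟨
    turns c                                                        ∎
    where
    open ≤-Reasoning
    go : ∀ v (p : Dec (m v ≡ c)) → 𝟙 p * turnsAt v ≤ sum (λ a → 𝟙 (tail a ≟ v) * (𝟙 (β a ≟ c) * 𝟙 (turn? a)))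
    go v (no _)     = z≤n
    go v (yes refl) = ≤-trans (≤-reflexive (*-identityˡ (turnsAt v))) (sum-mono λ a → inner a (tail a ≟ v))
      where
      inner : ∀ a (q : Dec (tail a ≡ v)) → 𝟙 q * 𝟙 (turn? a) ≤ 𝟙 q * (𝟙 (β a ≟ m v) * 𝟙 (turn? a))
      inner a (no _)   = z≤n
      inner a (yes ta) = ≤-reflexive (cong (1 *_) (sym (trans (cong (_* 𝟙 (turn? a)) (𝟙-yes (β a ≟ m v) (cong m ta))) (*-identityˡ _))))

  -- Two big vertices each have one turn more than their excess. A lone big vertex can use the turns
  -- of the whole cycle: `k` of them, two more than its excess.
  big-block-turns : BigBlock c → blockExcess c + 2 ≤ turns c
  big-block-turns (u , big-u , refl) with any? (λ v → ¬? (u ≟ v) ×-dec big? v ×-dec (m v ≟ m u))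
  ... | yes (v , u≢v , big-v , mv) = begin
    blockExcess (m u) + 2                                                       ≤⟨ +-monoʳ-≤ (blockExcess (m u)) two ⟩
    blockExcess (m u) + sum (λ x → 𝟙 (m x ≟ m u) * 𝟙 (big? x))                  ≡⟨ ∑-distrib-+ (λ x → 𝟙 (m x ≟ m u) * excess x) (λ x → 𝟙 (m x ≟ m u) * 𝟙 (big? x)) ⟨
    sum (λ x → 𝟙 (m x ≟ m u) * excess x + 𝟙 (m x ≟ m u) * 𝟙 (big? x))           ≡⟨ sum-cong-≗ (λ x → *-distribˡ-+ (𝟙 (m x ≟ m u)) (excess x) (𝟙 (big? x))) ⟨
    sum (λ x → 𝟙 (m x ≟ m u) * (excess x + 𝟙 (big? x)))                         ≤⟨ sum-mono (λ x → *-monoʳ-≤ (𝟙 (m x ≟ m u)) (excess≤turnsAt x)) ⟩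
    sum (λ x → 𝟙 (m x ≟ m u) * turnsAt x)                                       ≤⟨ sum-turnsAt (m u) ⟩
    turns (m u)                                                                 ∎
    where
    open ≤-Reasoning
    term : Fin n → ℕ
    term x = 𝟙 (m x ≟ m u) * 𝟙 (big? x)
    term≡1 : ∀ {x} → m x ≡ m u → Big x → term x ≡ 1
    term≡1 {x} p q = cong₂ _*_ (𝟙-yes (m x ≟ m u) p) (𝟙-yes (big? x) q)
    two : 2 ≤ sum term
    two = ≤-trans (≤-reflexive (sym (cong₂ (λ p q → p + (q + 0)) (term≡1 refl big-u) (term≡1 mv big-v))))
                  (sum-lookup-≤ ((u≢v All.∷ All.[]) ∷ All.[] ∷ []) term)
  ... | no none = begin
    blockExcess (m u) + 2        ≤⟨ +-monoˡ-≤ 2 (sum-mono λ x → go x (u ≟ x) (m x ≟ m u) (big? x)) ⟩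
    sum (λ x → 𝟙 (u ≟ x) * (k G D m x ∸ 2)) + 2  ≡⟨ cong (_+ 2) (sum-δ (λ x → k G D m x ∸ 2) u) ⟩
    k G D m u ∸ 2 + 2            ≡⟨ m∸n+n≡m (≤-trans (s≤s (s≤s z≤n)) (proj₂ big-u)) ⟩
    k G D m u                    ≤⟨ k≤turns big-u ⟩
    turns (m u)                  ∎
    where
    open ≤-Reasoning
    go : ∀ x (p : Dec (u ≡ x)) (q : Dec (m x ≡ m u)) (r : Dec (Big x)) → 𝟙 q * excess x ≤ 𝟙 p * (k G D m x ∸ 2)
    go x p         (no _)   r         = z≤n
    go x (yes _)   (yes _)  r         = *-monoʳ-≤ 1 (≤-trans (*-monoˡ-≤ _ (𝟙≤1 (¬? (x ∈? D)))) (≤-reflexive (*-identityˡ _)))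
    go x (no _)    (yes _)  (no ¬big) = ≤-reflexive (trans (*-identityˡ _) (excess-small ¬big))
    go x (no u≢x)  (yes mx) (yes big) = contradiction (x , u≢x , big , mx) none

  -- Charges of corners and blocks

  Digon Triangle Other Quiet : Fin darts → Set
  -- These equations say that the length of the face divides 2 or 3. For a live dart it is then
  -- exactly 2 or 3, because `φ` moves live darts.
  Digon b    = φ (φ b) ≡ b
  Triangle b = φ (φ (φ b)) ≡ b
  Other b    = Live b × ¬ Digon b × ¬ Triangle b
  Quiet b    = Live b × β b ≡ h (φ b) × ¬ Digon b × ¬ BigBlock (β (φ b))

  quiet? : ∀ b → Dec (Quiet b)
  quiet? b = live? b ×-dec (β b ≟ h (φ b)) ×-dec ¬? (φ (φ b) ≟ b) ×-dec ¬? (bigBlock? (β (φ b)))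

  FaceTurn : Fin darts → Set
  FaceTurn b = Live b × β b ≢ h (φ b)

  faceTurn? : ∀ b → Dec (FaceTurn b)
  faceTurn? b = live? b ×-dec ¬? (β b ≟ h (φ b))

  charge : Fin darts → ℕ
  charge b = 𝟙 (faceTurn? b) + 2 * 𝟙 (quiet? b)

  φ-α : φ (α x) ≡ σ x
  φ-α = cong σ (α-involutive _)

  turn-charge : ∀ a → 𝟙 (turn? a) ≤ charge (α a)
  turn-charge a = ≤-trans (𝟙-mono (turn? a) (faceTurn? (α a)) (λ (live , neq) →
    live-α live , λ eq → neq (trans (sym (β-α live)) (trans eq (cong h φ-α))))) (m≤m+n _ _)

  blockCharge : Fin n → ℕ
  blockCharge c = sum λ a → 𝟙 (β a ≟ c) * charge (α a)

  turns≤charge : ∀ c → turns c ≤ blockCharge c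
  turns≤charge c = sum-mono λ a → *-monoʳ-≤ (𝟙 (β a ≟ c)) (turn-charge a)

  -- If all corners at the block of a belong to digons, then α maps its darts onto the darts of the
  -- block of α a, so the latter has only one neighbouring block.
  all-digons-absurd : ¬ BigBlock (β a) → Live a → ¬ (∀ {y} → InBlock (β a) y → Digon (α y))
  all-digons-absurd {a} ¬big la digons = go (proj₂ la)
    where
    Back : Fin darts → Set
    Back w = Live w × h w ≡ β a
    back-σ : Back w → Back (σ w)
    back-σ {w} (lw , hw) with periodic injective (α w)
    ... | i , eq = live-σ lw , (begin
      h (σ w)          ≡⟨ cong h φ-α ⟨
      h (φ (α w))      ≡⟨ cong (h ∘ φ) σu ⟨
      h (φ (σ u))      ≡⟨ cong (h ∘ φ) φ-α ⟨
      h (φ (φ (α u)))  ≡⟨ cong h (digons iu) ⟩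
      h (α u)          ≡⟨ h-α (proj₁ iu) ⟩
      β u              ≡⟨ proj₂ iu ⟩
      β a              ∎)
      where
      open ≡-Reasoning
      u : Fin darts
      u = iter σ i (α w)
      iu : InBlock (β a) u
      iu = iter-closed (InBlock (β a)) in-block-σ i (live-α lw , trans (β-α lw) hw)
      σu : σ u ≡ α w
      σu = trans (sym (iter-suc {f = σ} i)) eq
    go : ¬ (Big (tail a) ⊎ Big (head a))
    go (inj₁ big) = ¬big (tail a , big , refl)
    go (inj₂ big) with big-labels big (β a)
    ... | b , lb , tb , hb with block-iter (live-α la) lb (trans (β-α la) (sym (cong m tb)))
    ...   | i , refl = hb (proj₂ (iter-closed Back back-σ i (live-α la , h-α la)))

  Occupied : Fin n → Set
  Occupied c = ∃ (InBlock c)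

  occupied? : ∀ c → Dec (Occupied c)
  occupied? c = any? λ a → live? a ×-dec (β a ≟ c)

  -- A cyclic sequence cannot change just once: the label taken up after `a` is given up again
  -- before the walk returns to `a`.
  two-turns : InBlock c a → Turn a → 2 ≤ turns c
  two-turns {c} {a} ia ta with turn-with-label (in-block-σ ia) ia (proj₂ ta ∘ sym)
  ... | y , ty , βy , hy = ≤-trans (≤-reflexive (sym (cong₂ (λ p q → p + (q + 0)) (term≡1 (proj₂ ia) ta) (term≡1 βy ty))))
                                   (sum-lookup-≤ ((a≢y All.∷ All.[]) ∷ All.[] ∷ []) term)
    where
    term : Fin darts → ℕ
    term x = 𝟙 (β x ≟ c) * 𝟙 (turn? x)
    term≡1 : ∀ {x} → β x ≡ c → Turn x → term x ≡ 1
    term≡1 {x} p q = cong₂ _*_ (𝟙-yes (β x ≟ c) p) (𝟙-yes (turn? x) q)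
    a≢y : a ≢ y
    a≢y refl = proj₂ ta hy

  -- One turn brings a second. Without turns all live edges of the block lead to the same block; the
  -- corners cannot all belong to digons, and a single other corner is already worth 2.
  small-block-charge : ¬ BigBlock c → Occupied c → 2 ≤ blockCharge c
  small-block-charge {c} ¬big (a , la , refl) with any? (λ y → (live? y ×-dec (β y ≟ c)) ×-dec turn? y)
  ... | yes (y , iy , ty) = ≤-trans (two-turns iy ty) (turns≤charge c)
  ... | no ¬turn with any? (λ y → (live? y ×-dec (β y ≟ c)) ×-dec ¬? (φ (φ (α y)) ≟ α y))
  ...   | no none = contradiction (λ {y} iy → decidable-stable (φ (φ (α y)) ≟ α y) λ ¬digon → none (y , iy , ¬digon))
                                  (all-digons-absurd ¬big la)
  ...   | yes (y , (ly , βy) , ¬digon) = begin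
    2                                          ≤⟨ m≤n+m 2 (𝟙 (faceTurn? (α y))) ⟩
    𝟙 (faceTurn? (α y)) + 2                    ≡⟨ cong (λ q → 𝟙 (faceTurn? (α y)) + 2 * q) (𝟙-yes (quiet? (α y)) quiet) ⟨
    charge (α y)                               ≡⟨ *-identityˡ (charge (α y)) ⟨
    1 * charge (α y)                           ≡⟨ cong (_* charge (α y)) (𝟙-yes (β y ≟ c) βy) ⟨
    𝟙 (β y ≟ c) * charge (α y)                 ≤⟨ term≤sum (λ y → 𝟙 (β y ≟ c) * charge (α y)) y ⟩
    blockCharge c                              ∎
    where
    open ≤-Reasoning
    no-turn : h y ≡ h (σ y)
    no-turn = decidable-stable (h y ≟ h (σ y)) λ neq → ¬turn (y , (ly , βy) , ly , neq)
    quiet : Quiet (α y)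
    quiet = live-α ly , trans (β-α ly) (trans no-turn (cong h (sym φ-α))) , ¬digon ,
      λ big → ¬big (subst BigBlock (trans (cong β φ-α) (trans β-σ βy)) big)

  small-block-excess : ¬ BigBlock c → blockExcess c ≡ 0
  small-block-excess {c} ¬big = trans (sum-cong-≗ λ v → go v (m v ≟ c)) (trans (sum-const n 0) (*-zeroʳ n))
    where
    go : ∀ v (p : Dec (m v ≡ c)) → 𝟙 p * excess v ≡ 0
    go v (no _)   = refl
    go v (yes mv) = trans (*-identityˡ _) (excess-small λ big → ¬big (v , big , mv))

  block-bound : ∀ c → blockExcess c + 2 * 𝟙 (occupied? c) ≤ blockCharge c
  block-bound c with bigBlock? c
  ... | yes big = ≤-trans (+-monoʳ-≤ (blockExcess c) (*-monoʳ-≤ 2 (𝟙≤1 (occupied? c))))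
                          (≤-trans (big-block-turns big) (turns≤charge c))
  ... | no ¬big = subst (λ e → e + 2 * 𝟙 (occupied? c) ≤ blockCharge c) (sym (small-block-excess ¬big)) (go (occupied? c))
    where
    go : (p : Dec (Occupied c)) → 2 * 𝟙 p ≤ blockCharge c
    go (yes occ) = small-block-charge ¬big occ
    go (no _)    = z≤n

  -- Summation over the blocks, and weights for counting edges and faces

  totalCharge liveCount deadCount occupiedCount : ℕ
  totalCharge   = sum charge
  liveCount     = sum λ a → 𝟙 (live? a)
  deadCount     = sum λ a → 𝟙 (¬? (live? a))
  occupiedCount = sum λ c → 𝟙 (occupied? c)

  W≡ : W G D m ≡ sum excess
  W≡ = sum-filter (λ v → ¬? (v ∈? D)) (λ v → k G D m v ∸ 2) id

  charge-bound : W G D m + 2 * occupiedCount ≤ totalCharge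
  charge-bound = begin
    W G D m + 2 * occupiedCount                           ≡⟨ cong₂ _+_ (trans W≡ (sum-fibres m excess)) (sym (*-distribˡ-sum 2 λ c → 𝟙 (occupied? c))) ⟩
    sum blockExcess + sum (λ c → 2 * 𝟙 (occupied? c))     ≡⟨ ∑-distrib-+ blockExcess (λ c → 2 * 𝟙 (occupied? c)) ⟨
    sum (λ c → blockExcess c + 2 * 𝟙 (occupied? c))       ≤⟨ sum-mono block-bound ⟩
    sum blockCharge                                       ≡⟨ sum-fibres β (charge ∘ α) ⟨
    sum (charge ∘ α)                                      ≤⟨ sum-reindex-≤ α-injective charge ⟩
    totalCharge                                           ∎
    where open ≤-Reasoning

  -- The darts of any face have total share at least 12.
  share′ : {A B : Set} → Dec A → Dec B → ℕ
  share′ (yes _) _       = 6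
  share′ (no _)  (yes _) = 4
  share′ (no _)  (no _)  = 3

  share : Fin darts → ℕ
  share b = share′ (φ (φ b) ≟ b) (φ (φ (φ b)) ≟ b)

  share-digon : Digon b → share b ≡ 6
  share-digon {b} digon with φ (φ b) ≟ b
  ... | yes _     = refl
  ... | no ¬digon = contradiction digon ¬digon

  share-triangle : ¬ Digon b → Triangle b → share b ≡ 4
  share-triangle {b} ¬digon tri with φ (φ b) ≟ b | φ (φ (φ b)) ≟ b
  ... | yes digon | _       = contradiction digon ¬digon
  ... | no _      | yes _   = refl
  ... | no _      | no ¬tri = contradiction tri ¬tri

  share-other : ¬ Digon b → ¬ Triangle b → share b ≡ 3
  share-other {b} ¬digon ¬tri with φ (φ b) ≟ b | φ (φ (φ b)) ≟ b
  ... | yes digon | _       = contradiction digon ¬digon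
  ... | no _      | yes tri = contradiction tri ¬tri
  ... | no _      | no _    = refl

  -- The scale 12 is the least common multiple of 2, 3 and 4, the numbers of darts among which a
  -- face divides it. A dead dart is an edge orbit and a face by itself, so it carries the full 12
  -- alone.
  weigh : (Fin darts → ℕ) → Fin darts → ℕ
  weigh s b = 𝟙 (live? b) * s b + 12 * 𝟙 (¬? (live? b))

  weigh-live : ∀ {s} → Live b → weigh s b ≡ s b
  weigh-live {b} {s} live = trans (cong₂ (λ p q → p * s b + 12 * q) (𝟙-yes (live? b) live) (𝟙-no (¬? (live? b)) λ ¬live → ¬live live))
    (trans (+-identityʳ _) (*-identityˡ (s b)))

  weigh-dead : ∀ {s} → ¬ Live b → weigh s b ≡ 12
  weigh-dead {b} {s} ¬live = cong₂ (λ p q → p * s b + 12 * q) (𝟙-no (live? b) ¬live) (𝟙-yes (¬? (live? b)) ¬live)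

  sum-weigh : ∀ s → sum (weigh s) ≡ sum (λ b → 𝟙 (live? b) * s b) + 12 * deadCount
  sum-weigh s = trans (∑-distrib-+ (λ b → 𝟙 (live? b) * s b) (λ b → 12 * 𝟙 (¬? (live? b))))
    (cong (sum (λ b → 𝟙 (live? b) * s b) +_) (*-distribˡ-sum 12 λ b → 𝟙 (¬? (live? b))))

  Heavy : (Fin darts → Fin darts) → (Fin darts → ℕ) → Fin darts → Set
  Heavy f s x = ∃ λ xs → Unique xs × All (x ∼[ f ]_) xs × 12 ≤ sum (weigh s ∘ lookup xs)

  heavy-dead : ∀ {f} s → ¬ Live x → Heavy f s x
  heavy-dead {x} s ¬live = (x ∷ []) , All.[] ∷ [] , ε All.∷ All.[] ,
    ≤-reflexive (sym (cong (_+ 0) (weigh-dead {s = s} ¬live)))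

  heavy-edge : ∀ x → Heavy α (λ _ → 6) x
  heavy-edge x with live? x
  ... | no ¬live = heavy-dead (λ _ → 6) ¬live
  ... | yes live = x ∷ α x ∷ [] , ((α-moves live ∘ sym) All.∷ All.[]) ∷ All.[] ∷ [] ,
    ε All.∷ Eq.return refl All.∷ All.[] ,
    ≤-reflexive (sym (cong₂ (λ p q → p + (q + 0)) (weigh-live {s = λ _ → 6} live) (weigh-live {s = λ _ → 6} (live-α live))))

  -- There are no faces of length 1 on live darts. On a face of length at least 4, four consecutive
  -- darts already reach the weight, whatever the length.
  heavy-face : ∀ x → Heavy φ share x
  heavy-face x with live? x
  ... | no ¬live = heavy-dead share ¬live
  ... | yes live = go (φ (φ x) ≟ x) (φ (φ (φ x)) ≟ x)
    where
    x≢φ : x ≢ φ x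
    x≢φ = φ-moves live ∘ sym
    weight : ∀ {y s} → Live y → share y ≡ s → weigh share y ≡ s
    weight ly eq = trans (weigh-live {s = share} ly) eq
    r₁ : x ∼[ φ ] φ x
    r₁ = Eq.return refl
    r₂ : x ∼[ φ ] φ (φ x)
    r₂ = r₁ ◅◅ Eq.return refl
    r₃ : x ∼[ φ ] φ (φ (φ x))
    r₃ = r₂ ◅◅ Eq.return refl
    l₁ : Live (φ x)
    l₁ = live-φ live
    l₂ : Live (φ (φ x))
    l₂ = live-φ l₁
    l₃ : Live (φ (φ (φ x)))
    l₃ = live-φ l₂
    go : Dec (Digon x) → Dec (Triangle x) → Heavy φ share x
    go (yes d) _ = x ∷ φ x ∷ [] , (x≢φ All.∷ All.[]) ∷ All.[] ∷ [] , ε All.∷ r₁ All.∷ All.[] ,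
      ≤-reflexive (sym (cong₂ (λ p q → p + (q + 0)) (weight live (share-digon d)) (weight l₁ (share-digon (cong φ d)))))
    go (no ¬d) (yes t) = x ∷ φ x ∷ φ (φ x) ∷ [] ,
      (x≢φ All.∷ (¬d ∘ sym) All.∷ All.[]) ∷ ((x≢φ ∘ φ-injective) All.∷ All.[]) ∷ All.[] ∷ [] ,
      ε All.∷ r₁ All.∷ r₂ All.∷ All.[] ,
      ≤-reflexive (sym (cong₂ _+_ (weight live (share-triangle ¬d t)) (cong₂ (λ p q → p + (q + 0))
        (weight l₁ (share-triangle (¬d ∘ φ-injective) (cong φ t)))
        (weight l₂ (share-triangle (¬d ∘ φ-injective ∘ φ-injective) (cong (φ ∘ φ) t))))))
    go (no ¬d) (no ¬t) = x ∷ φ x ∷ φ (φ x) ∷ φ (φ (φ x)) ∷ [] ,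
      (x≢φ All.∷ (¬d ∘ sym) All.∷ (¬t ∘ sym) All.∷ All.[]) ∷ ((x≢φ ∘ φ-injective) All.∷ (¬d ∘ sym ∘ φ-injective) All.∷ All.[]) ∷
        ((x≢φ ∘ φ-injective ∘ φ-injective) All.∷ All.[]) ∷ All.[] ∷ [] ,
      ε All.∷ r₁ All.∷ r₂ All.∷ r₃ All.∷ All.[] ,
      ≤-reflexive (sym (cong₂ _+_ (weight live (share-other ¬d ¬t)) (cong₂ _+_
        (weight l₁ (share-other (¬d ∘ φ-injective) (¬t ∘ φ-injective))) (cong₂ (λ p q → p + (q + 0))
        (weight l₂ (share-other (¬d ∘ φ-injective ∘ φ-injective) (¬t ∘ φ-injective ∘ φ-injective)))
        (weight l₃ (share-other (¬d ∘ φ-injective ∘ φ-injective ∘ φ-injective) (¬t ∘ φ-injective ∘ φ-injective ∘ φ-injective)))))))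

  -- Upper bound for the charge of the faces

  other? : ∀ b → Dec (Other b)
  other? b = live? b ×-dec ¬? (φ (φ b) ≟ b) ×-dec ¬? (φ (φ (φ b)) ≟ b)

  other-φ : Other b → Other (φ b)
  other-φ (live , ¬d , ¬t) = live-φ live , ¬d ∘ φ-injective , ¬t ∘ φ-injective

  SmallHead SmallTail : Fin darts → Set
  SmallHead b = Other b × ¬ BigBlock (β (φ b))
  SmallTail b = Other b × ¬ BigBlock (β b)

  smallHead? : ∀ b → Dec (SmallHead b)
  smallHead? b = other? b ×-dec ¬? (bigBlock? (β (φ b)))

  smallTail? : ∀ b → Dec (SmallTail b)
  smallTail? b = other? b ×-dec ¬? (bigBlock? (β b))

  -- A live edge has a big end, so one of the two blocks that it joins contains a big vertex.
  small-disjoint : SmallHead b → ¬ SmallTail b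
  small-disjoint {b} ((live , _) , ¬head) (_ , ¬tail) =
    [ (λ big → ¬tail (tail b , big , refl)) , (λ big → ¬head (head b , big , sym (β-φ live))) ]′ (proj₂ live)

  h-φ : Live b → h (φ b) ≡ β (φ (φ b))
  h-φ live = sym (β-φ (live-φ live))

  digon-no-turn : Digon b → ¬ FaceTurn b
  digon-no-turn d (live , neq) = neq (trans (cong β (sym d)) (sym (h-φ live)))

  -- Otherwise the third dart of the triangle would join a block to itself.
  triangle-turns : Live b → Triangle b → β b ≢ h (φ b)
  triangle-turns {b} live t eq = proj₁ (live-φ (live-φ live))
    (trans (sym (h-φ live)) (trans (sym eq) (trans (cong β (sym t)) (β-φ (live-φ (live-φ live))))))

  -- The allowance `3ℓ − 6`, doubled and split among the darts: `2 * charge + share` should be at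
  -- most 6 per dart. Digons and triangles meet this dart by dart. On longer faces it holds only on
  -- average, since a quiet corner reaches 7 and a turn 5; so each dart there pays 1, and each dart
  -- with a small head block receives 2.
  dart-bound : ∀ b → 2 * charge b + 𝟙 (live? b) * share b + 𝟙 (other? b) ≤ 6 * 𝟙 (live? b) + 2 * 𝟙 (smallHead? b)
  dart-bound b = go (live? b) (φ (φ b) ≟ b) (φ (φ (φ b)) ≟ b) (faceTurn? b) (quiet? b) (other? b) (smallHead? b)
    where
    six : ∀ {x} j → j ≤ 6 → j ≤ 6 + x
    six j j≤6 = ≤-trans j≤6 (m≤m+n 6 _)
    go : (l : Dec (Live b)) (d : Dec (Digon b)) (t : Dec (Triangle b)) (f : Dec (FaceTurn b)) (q : Dec (Quiet b))
         (o : Dec (Other b)) (s : Dec (SmallHead b)) →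
         2 * (𝟙 f + 2 * 𝟙 q) + 𝟙 l * share′ d t + 𝟙 o ≤ 6 * 𝟙 l + 2 * 𝟙 s
    go (no ¬l) d t (yes f) q o s             = contradiction (proj₁ f) ¬l
    go (no ¬l) d t (no _) (yes q) o s        = contradiction (proj₁ q) ¬l
    go (no ¬l) d t (no _) (no _) (yes o) s   = contradiction (proj₁ o) ¬l
    go (no ¬l) d t (no _) (no _) (no _) s    = z≤n
    go (yes l) (yes d) t (yes f) q o s       = contradiction f (digon-no-turn d)
    go (yes l) (yes d) t (no _) (yes q) o s  = contradiction d (proj₁ (proj₂ (proj₂ q)))
    go (yes l) (yes d) t (no _) (no _) (yes o) s = contradiction d (proj₁ (proj₂ o))
    go (yes l) (yes d) t (no _) (no _) (no _) s  = six 6 (≤ᵇ⇒≤ 6 6 _)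
    go (yes l) (no _) (yes t) f (yes q) o s  = contradiction (proj₁ (proj₂ q)) (triangle-turns l t)
    go (yes l) (no _) (yes t) f (no _) (yes o) s = contradiction t (proj₂ (proj₂ o))
    go (yes l) (no _) (yes t) (yes _) (no _) (no _) s = six 6 (≤ᵇ⇒≤ 6 6 _)
    go (yes l) (no _) (yes t) (no _) (no _) (no _) s = six 4 (≤ᵇ⇒≤ 4 6 _)
    go (yes l) (no _) (no _) (yes f) (yes q) o s = contradiction (proj₁ (proj₂ q)) (proj₂ f)
    go (yes l) (no _) (no _) (yes f) (no _) (yes _) s = six 6 (≤ᵇ⇒≤ 6 6 _)
    go (yes l) (no _) (no _) (yes f) (no _) (no _) s = six 5 (≤ᵇ⇒≤ 5 6 _)
    go (yes l) (no ¬d) (no ¬t) (no _) (yes q) o (no ¬s) = contradiction ((l , ¬d , ¬t) , proj₂ (proj₂ (proj₂ q))) ¬s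
    go (yes l) (no _) (no _) (no _) (yes q) (yes _) (yes _) = ≤ᵇ⇒≤ 8 8 _
    go (yes l) (no _) (no _) (no _) (yes q) (no _) (yes _) = ≤ᵇ⇒≤ 7 8 _
    go (yes l) (no _) (no _) (no _) (no _) (yes _) s = six 4 (≤ᵇ⇒≤ 4 6 _)
    go (yes l) (no _) (no _) (no _) (no _) (no _) s = six 3 (≤ᵇ⇒≤ 3 6 _)

  totalShare : ℕ
  totalShare = sum λ b → 𝟙 (live? b) * share b

  -- The receipts in `dart-bound` do not exceed the payments: `φ` injects the darts with small head
  -- block into those with small tail block, and no dart is of both kinds, so at most half of the
  -- darts of long faces receive anything.
  face-bound : 2 * totalCharge + totalShare ≤ 6 * liveCount
  face-bound = +-cancelʳ-≤ others (2 * totalCharge + totalShare) (6 * liveCount) (begin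
    2 * totalCharge + totalShare + others
      ≡⟨ cong (λ c → c + totalShare + others) (*-distribˡ-sum 2 charge) ⟨
    sum (λ b → 2 * charge b) + totalShare + others
      ≡⟨ cong (_+ others) (∑-distrib-+ (λ b → 2 * charge b) (λ b → 𝟙 (live? b) * share b)) ⟨
    sum (λ b → 2 * charge b + 𝟙 (live? b) * share b) + others
      ≡⟨ ∑-distrib-+ (λ b → 2 * charge b + 𝟙 (live? b) * share b) (λ b → 𝟙 (other? b)) ⟨
    sum (λ b → 2 * charge b + 𝟙 (live? b) * share b + 𝟙 (other? b))
      ≤⟨ sum-mono dart-bound ⟩
    sum (λ b → 6 * 𝟙 (live? b) + 2 * 𝟙 (smallHead? b))
      ≡⟨ ∑-distrib-+ (λ b → 6 * 𝟙 (live? b)) (λ b → 2 * 𝟙 (smallHead? b)) ⟩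
    sum (λ b → 6 * 𝟙 (live? b)) + sum (λ b → 2 * 𝟙 (smallHead? b))
      ≡⟨ cong₂ _+_ (*-distribˡ-sum 6 λ b → 𝟙 (live? b)) (*-distribˡ-sum 2 λ b → 𝟙 (smallHead? b)) ⟩
    6 * liveCount + 2 * heads
      ≤⟨ +-monoʳ-≤ (6 * liveCount) 2heads≤others ⟩
    6 * liveCount + others ∎)
    where
    open ≤-Reasoning
    others = sum λ b → 𝟙 (other? b)
    heads  = sum λ b → 𝟙 (smallHead? b)
    tails  = sum λ b → 𝟙 (smallTail? b)
    heads≤tails : heads ≤ tails
    heads≤tails = ≤-trans (sum-mono λ b → 𝟙-mono (smallHead? b) (smallTail? (φ b)) λ (o , ¬big) → other-φ o , ¬big)
                          (sum-reindex-≤ φ-injective λ b → 𝟙 (smallTail? b))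
    exclusive : ∀ b (p : Dec (SmallHead b)) (q : Dec (SmallTail b)) → 𝟙 p + 𝟙 q ≤ 𝟙 (other? b)
    exclusive b (no _)  q       = 𝟙-mono q (other? b) proj₁
    exclusive b (yes p) (yes q) = contradiction q (small-disjoint p)
    exclusive b (yes p) (no _)  = ≤-reflexive (sym (𝟙-yes (other? b) (proj₁ p)))
    2heads≤others : 2 * heads ≤ others
    2heads≤others = begin
      heads + (heads + 0)                                   ≡⟨ cong (heads +_) (+-identityʳ heads) ⟩
      heads + heads                                         ≤⟨ +-monoʳ-≤ heads heads≤tails ⟩
      heads + tails                                         ≡⟨ ∑-distrib-+ (λ b → 𝟙 (smallHead? b)) (λ b → 𝟙 (smallTail? b)) ⟨
      sum (λ b → 𝟙 (smallHead? b) + 𝟙 (smallTail? b))       ≤⟨ sum-mono (λ b → exclusive b (smallHead? b) (smallTail? b)) ⟩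
      others                                                ∎

  -- Euler's formula for the reduced map

  open Spherical spherical

  dead-or-live : darts ≡ liveCount + deadCount
  dead-or-live = begin
    darts                                           ≡⟨ trans (sum-const darts 1) (*-identityʳ darts) ⟨
    sum {darts} (λ _ → 1)                           ≡⟨ sum-cong-≗ (λ b → go (live? b)) ⟩
    sum (λ b → 𝟙 (live? b) + 𝟙 (¬? (live? b)))      ≡⟨ ∑-distrib-+ (λ b → 𝟙 (live? b)) (λ b → 𝟙 (¬? (live? b))) ⟩
    liveCount + deadCount                           ∎
    where
    open ≡-Reasoning
    go : {A : Set} (p : Dec A) → 1 ≡ 𝟙 p + 𝟙 (¬? p)
    go (yes _) = refl
    go (no _)  = refl

  edge-count : E * 12 ≤ 6 * liveCount + 12 * deadCount
  edge-count = ≤-trans (classes-weight edges (weigh (λ _ → 6)) 12 heavy-edge) (≤-reflexive (trans (sum-weigh (λ _ → 6))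
    (cong (λ s → s + 12 * deadCount) (trans (sum-cong-≗ λ b → *-comm (𝟙 (live? b)) 6) (*-distribˡ-sum 6 λ b → 𝟙 (live? b))))))

  face-count : F * 12 ≤ totalShare + 12 * deadCount
  face-count = ≤-trans (classes-weight faces (weigh share) 12 heavy-face) (≤-reflexive (sum-weigh share))

  rep : Fin V → Fin darts
  rep j = proj₁ (Classes.surjective vertices j)

  rep-injective : ∀ {i j} → rep i ∼[ σ ] rep j → i ≡ j
  rep-injective {i} {j} r = trans (sym (proj₂ (Classes.surjective vertices i)))
    (trans (related vertices r) (proj₂ (Classes.surjective vertices j)))

  -- One dart is chosen from each `σ`-orbit. Live ones from different orbits lie in different
  -- blocks; dead ones are counted as darts.
  vertex-count : V ≤ occupiedCount + deadCount
  vertex-count = begin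
    V                                                     ≡⟨ trans (sum-const V 1) (*-identityʳ V) ⟨
    sum {V} (λ _ → 1)                                     ≡⟨ sum-cong-≗ (λ j → go (live? (rep j))) ⟩
    sum (λ j → 𝟙 (live? (rep j)) + 𝟙 (¬? (live? (rep j))))
      ≡⟨ ∑-distrib-+ (λ j → 𝟙 (live? (rep j))) (λ j → 𝟙 (¬? (live? (rep j)))) ⟩
    sum (λ j → 𝟙 (live? (rep j))) + sum (λ j → 𝟙 (¬? (live? (rep j))))
      ≤⟨ +-mono-≤
           (count-≤ (λ j → live? (rep j)) occupied? (λ j c → β (rep j) ≟ c) (λ {j} live → β (rep j) , (rep j , live , refl) , refl)
             (λ lᵢ lⱼ p q → rep-injective (block-related lᵢ lⱼ (trans p (sym q)))))
           (sum-reindex-≤ (λ eq → rep-injective (subst (rep _ ∼[ σ ]_) eq ε)) (λ b → 𝟙 (¬? (live? b)))) ⟩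
    occupiedCount + deadCount                             ∎
    where
    open ≤-Reasoning
    go : {A : Set} (p : Dec A) → 1 ≡ 𝟙 p + 𝟙 (¬? p)
    go (yes _) = refl
    go (no _)  = refl

  dead-isolated : ¬ Live x → EqClosure (σ ∪ˢ α) x y → y ≡ x
  dead-isolated ¬live = isolated
    [ (λ eq → injective (trans eq (sym (σ-dead ¬live)))) , (λ eq → α-injective (trans eq (sym (α₂-dead ¬live)))) ]′
    [ (λ eq → trans (sym eq) (σ-dead ¬live)) , (λ eq → trans (sym eq) (α₂-dead ¬live)) ]′

  -- Each dead dart is a component of its own. The one further component, that of `a`, is the source
  -- of the constant 12 in the theorem.
  component-count : Live a → deadCount + 1 ≤ C
  component-count {a} la = begin
    deadCount + 1                                       ≡⟨ cong (λ s → deadCount + s) (sum-δ (λ _ → 1) a) ⟨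
    deadCount + sum (λ b → 𝟙 (a ≟ b) * 1)               ≡⟨ ∑-distrib-+ (λ b → 𝟙 (¬? (live? b))) (λ b → 𝟙 (a ≟ b) * 1) ⟨
    sum (λ b → 𝟙 (¬? (live? b)) + 𝟙 (a ≟ b) * 1)        ≤⟨ sum-mono (λ b → exclusive b (live? b) (a ≟ b)) ⟩
    sum (λ b → 𝟙 (marked? b))                           ≤⟨ count-≤ marked? (λ _ → yes a) (λ b j → Classes.class components b ≟ j)
                                                             (λ _ → _ , a , refl)
                                                             (λ p q eq eq′ → apart p q (relate components (trans eq (sym eq′)))) ⟩
    sum {C} (λ _ → 1)                                   ≡⟨ trans (sum-const C 1) (*-identityʳ C) ⟩
    C                                                   ∎
    where
    open ≤-Reasoning
    Marked : Fin darts → Set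
    Marked b = ¬ Live b ⊎ a ≡ b
    marked? : ∀ b → Dec (Marked b)
    marked? b = ¬? (live? b) ⊎-dec (a ≟ b)
    exclusive : ∀ b (l : Dec (Live b)) (e : Dec (a ≡ b)) → 𝟙 (¬? l) + 𝟙 e * 1 ≤ 𝟙 (¬? l ⊎-dec e)
    exclusive b (yes _) (yes _)   = ≤-refl
    exclusive b (yes _) (no _)    = ≤-refl
    exclusive b (no ¬l) (yes refl) = contradiction la ¬l
    exclusive b (no _)  (no _)    = ≤-refl
    apart : ∀ {x y} → Marked x → Marked y → EqClosure (σ ∪ˢ α) x y → x ≡ y
    apart (inj₁ ¬lx)  _           r = sym (dead-isolated ¬lx r)
    apart (inj₂ _)    (inj₁ ¬ly)  r = dead-isolated ¬ly (eq-sym r)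
    apart (inj₂ refl) (inj₂ refl) r = refl

  occupied≤∣D∣ : occupiedCount ≤ ∣ D ∣
  occupied≤∣D∣ = ≤-trans (sum-mono λ c → 𝟙-mono (occupied? c) (c ∈? D) λ { (a , _ , refl) → owner-∈ _ }) (≤-reflexive (sym (∣p∣≡sum D)))

  no-live-W : (∀ a → ¬ Live a) → W G D m ≡ 0
  no-live-W none = trans W≡ (trans (sum-cong-≗ λ v → excess-small (not-big v)) (trans (sum-const n 0) (*-zeroʳ n)))
    where
    not-big : ∀ v → ¬ Big v
    not-big v big with big-labels big v
    ... | a , live , _ = none a live

  -- Twelve times Euler's formula is combined with the face bound and with twice the charge bound.
  -- The terms in `l`, `z` and `s` cancel, leaving `(w + 12) * 2 ≤ 4 * o * 2`.
  arithmetic : ∀ {d l z V E F C t s w o D} → d ≡ l + z → d + 2 * C ≤ V + E + F → V ≤ o + z → E * 12 ≤ 6 * l + 12 * z →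
               F * 12 ≤ s + 12 * z → z + 1 ≤ C → 2 * t + s ≤ 6 * l → w + 2 * o ≤ t → o ≤ D → w + 12 ≤ 4 * D
  arithmetic {d} {l} {z} {V} {E} {F} {C} {t} {s} {w} {o} {D} refl e v≤ e≤ f≤ c≤ t≤ w≤ o≤ =
    ≤-trans (*-cancelʳ-≤ (w + 12) (4 * o) 2 (+-cancelʳ-≤ (4 * o + 12 * l + 36 * z + s) _ _ (begin
      (w + 12) * 2 + (4 * o + 12 * l + 36 * z + s)            ≡⟨ e₁ w o l z s ⟩
      2 * (w + 2 * o) + s + 12 * (l + z + 2 * (z + 1))        ≤⟨ +-mono-≤ (+-monoˡ-≤ s (*-monoʳ-≤ 2 w≤)) (*-monoʳ-≤ 12 (+-monoʳ-≤ (l + z) (*-monoʳ-≤ 2 c≤))) ⟩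
      2 * t + s + 12 * (l + z + 2 * C)                        ≤⟨ +-mono-≤ t≤ (*-monoʳ-≤ 12 e) ⟩
      6 * l + 12 * (V + E + F)                                ≡⟨ e₂ l V E F ⟩
      6 * l + (12 * V + E * 12 + F * 12)                      ≤⟨ +-monoʳ-≤ (6 * l) (+-mono-≤ (+-mono-≤ (*-monoʳ-≤ 12 v≤) e≤) f≤) ⟩
      6 * l + (12 * (o + z) + (6 * l + 12 * z) + (s + 12 * z))  ≡⟨ e₃ o l z s ⟩
      4 * o * 2 + (4 * o + 12 * l + 36 * z + s)               ∎))) (*-monoʳ-≤ 4 o≤)
    where
    open ≤-Reasoning
    e₁ : ∀ w o l z s → (w + 12) * 2 + (4 * o + 12 * l + 36 * z + s) ≡ 2 * (w + 2 * o) + s + 12 * (l + z + 2 * (z + 1))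
    e₁ = solve-∀
    e₂ : ∀ l V E F → 6 * l + 12 * (V + E + F) ≡ 6 * l + (12 * V + E * 12 + F * 12)
    e₂ = solve-∀
    e₃ : ∀ o l z s → 6 * l + (12 * (o + z) + (6 * l + 12 * z) + (s + 12 * z)) ≡ 4 * o * 2 + (4 * o + 12 * l + 36 * z + s)
    e₃ = solve-∀

  W-bound : W G D m ≡ 0 ⊎ W G D m + 12 ≤ 4 * ∣ D ∣
  W-bound with any? live?
  -- Without live darts there is no component to supply the 12, but then there is no big vertex
  -- either; this is where the positive part in the theorem comes from.
  ... | no none       = inj₁ (no-live-W λ a live → none (a , live))
  ... | yes (a , live) = inj₂ (arithmetic {l = liveCount} dead-or-live euler vertex-count edge-count face-count
                                 (component-count live) face-bound charge-bound occupied≤∣D∣)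

open import Data.Integer as ℤ using (ℤ; +_)
import Data.Integer.Properties as ℤ

theorem2p6 : ∀ {n : ℕ} (G : Graph n) → Planar G →
    ∀ (D : Subset n) → Dominating G D →
    ∀ (m : Fin n → Fin n) → IsOwnerAssignment G D m →
    (W G D m ≤ 4 * ∣ D ∣ ∸ 12) ×
    (0 < W G D m → + W G D m ℤ.≤ + 4 ℤ.* + ∣ D ∣ ℤ.- + 12)
theorem2p6 G planar D _ m owner with Discharging.W-bound G planar D m owner
... | inj₁ W≡0 = ≤-trans (≤-reflexive W≡0) z≤n , λ 0<W → contradiction W≡0 (m<n⇒n≢0 0<W)
... | inj₂ W+12≤ = W≤ , λ _ → subst (+ W G D m ℤ.≤_) (sym 4D-12) (ℤ.+≤+ W≤)
  where
  W≤ : W G D m ≤ 4 * ∣ D ∣ ∸ 12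
  W≤ = m+n≤o⇒m≤o∸n (W G D m) W+12≤
  4D-12 : + 4 ℤ.* + ∣ D ∣ ℤ.- + 12 ≡ + (4 * ∣ D ∣ ∸ 12)
  -- Here `12 ≤ 4 * ∣ D ∣`, so integer and truncated subtraction agree.
  4D-12 = trans (cong (ℤ._- + 12) (sym (ℤ.pos-* 4 ∣ D ∣)))
                (trans (ℤ.m-n≡m⊖n (4 * ∣ D ∣) 12) (ℤ.⊖-≥ (≤-trans (m≤n+m 12 _) W+12≤)))
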